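{- Given an EFD-sentence $\varphi$ (in the language $\{+,-,0,\vee,\wedge\}$) with a nontrivial model in $\mathcal{G}$, there is a positive integer $k$ such that $\varphi\sim\delta_k$ in $\mathcal{G}$.
   Context: $\mathcal G$ is the variety of Abelian $\ell$-groups in the language $\{+,-,0,\vee,\wedge\}$ ($(A,+,-,0)$ an Abelian group, $(A,\vee,\wedge)$ a lattice, $a+(b\vee c)=(a+b)\vee(a+c)$). An EFD-sentence is a sentence $\forall x_1\dots x_n\exists! z_1\dots z_m\bigwedge_{i=1}^k s_i(\bar x,\bar z)=t_i(\bar x,\bar z)$ with terms $s_i,t_i$, $n\ge0$, $m\ge1$. $\delta_k:=\forall x\exists! z\;kz=x$. For sentences $\varphi,\psi$ and a class $\mathcal K$, $\varphi\sim\psi$ in $\mathcal K$ means that for every $\mathbf A\in\mathcal K$, $\mathbf A\models\varphi$ iff $\mathbf A\models\psi$. -}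

module Defs where

open import Level using (Level) renaming (suc to lsuc)
open import Data.Nat using (ℕ; zero; suc) renaming (_+_ to _+ℕ_)
open import Data.Fin using (Fin; zero; suc)
open import Data.Vec using (Vec; lookup; _++_)
open import Data.List using (List; _∷_; [])
open import Data.List.Relation.Unary.All using (All)
open import Data.Product using (Σ; _×_; _,_)
open import Relation.Binary.PropositionalEquality using (_≡_)
open import Relation.Nullary using (¬_)
open import Algebra.Structures using (IsAbelianGroup)
open import Algebra.Lattice.Structures using (IsLattice)

record AbelianLGroup (a : Level) : Set (lsuc a) where
  infixl 6 _+_
  field
    Carrier : Set a
    _+_ : Carrier → Carrier → Carrier
    -_  : Carrier → Carrier
    0#  : Carrier
    _∨_ : Carrier → Carrier → Carrier
    _∧_ : Carrier → Carrier → Carrier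
    isAbelianGroup : IsAbelianGroup _≡_ _+_ 0# -_
    isLattice      : IsLattice _≡_ _∨_ _∧_
    +-distrib-∨    : ∀ x y z → x + (y ∨ z) ≡ (x + y) ∨ (x + z)

data Term (n : ℕ) : Set where
  var  : Fin n → Term n
  _⊕_  : Term n → Term n → Term n
  ⊖_   : Term n → Term n
  𝟘    : Term n
  _⊻_  : Term n → Term n → Term n
  _⊼_  : Term n → Term n → Term n

module _ {a} (A : AbelianLGroup a) where
  open AbelianLGroup A

  ⟦_⟧ : ∀ {n} → Term n → Vec Carrier n → Carrier
  ⟦ var i ⟧ ρ = lookup ρ i
  ⟦ s ⊕ t ⟧ ρ = ⟦ s ⟧ ρ + ⟦ t ⟧ ρ
  ⟦ ⊖ t ⟧ ρ   = - ⟦ t ⟧ ρ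
  ⟦ 𝟘 ⟧ ρ     = 0#
  ⟦ s ⊻ t ⟧ ρ = ⟦ s ⟧ ρ ∨ ⟦ t ⟧ ρ
  ⟦ s ⊼ t ⟧ ρ = ⟦ s ⟧ ρ ∧ ⟦ t ⟧ ρ

  Nontrivial : Set a
  Nontrivial = Σ Carrier λ x → ¬ (x ≡ 0#)

-- EFD-sentence  ∀ x₁…xₙ ∃! z₁…zₘ ⋀ᵢ sᵢ = tᵢ  with m = suc m' ≥ 1.
-- Variables 0..n-1 are the x's, variables n..n+m-1 are the z's.
record EFD : Set where
  field
    n   : ℕ
    m'  : ℕ
    eqs : List (Term (n +ℕ suc m') × Term (n +ℕ suc m'))

open EFD

module _ {a} (A : AbelianLGroup a) (φ : EFD) where
  open AbelianLGroup A

  Sat : Vec Carrier (n φ) → Vec Carrier (suc (m' φ)) → Set a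
  Sat x z = All (λ { (s , t) → ⟦ A ⟧ s (x ++ z) ≡ ⟦ A ⟧ t (x ++ z) }) (eqs φ)

  Models : Set a
  Models = (x : Vec Carrier (n φ)) →
           Σ (Vec Carrier (suc (m' φ))) λ z →
             Sat x z × (∀ z′ → Sat x z′ → z′ ≡ z)

_·_ : ∀ {n} → ℕ → Term n → Term n
zero  · t = 𝟘
suc k · t = t ⊕ (k · t)

δ : ℕ → EFD
δ k = record { n = 1 ; m' = 0 ; eqs = ((k · var (suc zero)) , var zero) ∷ [] }

{-# OPTIONS --safe #-}

-- Modulo a convex subgroup ⟨h⟩ an ℓ-group may be treated as a chain: since the polars of a⁺ and a⁻
-- meet in 0, what holds modulo ⟨h + a⁺⟩ and modulo ⟨h + a⁻⟩ holds modulo ⟨h⟩.  In a chain the solution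
-- set of φ is a finite union of rational polyhedral cones in the variables (x , z), and by Farkas'
-- lemma a linear inequality either follows from others in every ℓ-group or fails at an integer
-- point, hence in ℤc ⊆ B for any nontrivial B.  So uniqueness of solutions passes from B to every
-- ℓ-group and its quotients.  Fourier–Motzkin elimination of z, with comparisons of linear forms in x
-- decided by cutting the x-space into full-dimensional cells, finds on each cell a solution
-- z = L(x)/β, unless no cone has a solution there, which B ⊨ φ excludes.  At the multiples of integer
-- points of the cell φ forces the coefficients of L(x)/β to act on the group, i.e. divisibility by
-- β / gcd for each coefficient; conversely this divisibility solves φ on the cell, and solutions on
-- two adjacent cells are glued by the Chinese remainder theorem, thanks to uniqueness.  Then k is the
-- product of the integers obtained from the finitely many cells.
module Submission where

open import Defs
open import Level using (Level) renaming (suc to lsuc)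
open import Data.Nat using (ℕ; zero; suc; _≥_; z≤n; s≤s)
import Data.Nat as ℕ
import Data.Nat.Properties as ℕ
open import Data.Nat.GCD using (module Bézout; module GCD)
open import Data.Nat.Divisibility using (divides)
open import Data.Integer as ℤ using (ℤ; +_; -[1+_]; 0ℤ; 1ℤ; -1ℤ)
import Data.Integer.Properties as ℤ
open import Data.Integer.Tactic.RingSolver using (solve-∀)
open import Data.Fin using (Fin; zero; suc; splitAt; _↑ˡ_; _↑ʳ_)
open import Data.Vec using (Vec; []; _∷_; lookup; _++_; map; head; zipWith; replicate; tabulate)
open import Data.Vec.Properties using (lookup-splitAt; lookup-++ˡ; lookup-++ʳ; lookup∘tabulate; lookup-map; map-++)
open import Data.List using (List; []; _∷_; cartesianProductWith) renaming (_++_ to _++ᴸ_; map to mapᴸ)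
open import Data.List.Membership.Propositional using (_∈_)
open import Data.List.Membership.Propositional.Properties
  using (∈-cartesianProductWith⁺; ∈-cartesianProductWith⁻; ∈-map⁺; ∈-map⁻; ∈-++⁺ˡ; ∈-++⁺ʳ; ∈-++⁻)
open import Data.List.Relation.Unary.Any using (here; there)
open import Data.List.Relation.Unary.All as All using (All; []; _∷_)
open import Data.List.Relation.Unary.All.Properties using (++⁺; ++⁻ˡ; ++⁻ʳ; map⁺)
open import Data.Product using (Σ; _×_; _,_; proj₁; proj₂)
open import Data.Sum using (_⊎_; inj₁; inj₂; [_,_]′)
open import Data.Empty using (⊥-elim)
open import Data.Unit using (⊤; tt)
open import Function.Bundles using (_⇔_; mk⇔; Equivalence)
open import Function.Construct.Composition using (_⇔-∘_)
open import Relation.Nullary using (¬_)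
open import Relation.Binary.PropositionalEquality
open import Algebra.Bundles using (AbelianGroup)
open import Algebra.Lattice.Bundles using (Lattice)
import Algebra.Properties.AbelianGroup
import Algebra.Properties.CommutativeMonoid.Mult
import Algebra.Lattice.Properties.Lattice
import Relation.Binary.Lattice

-- Integral linear forms

Form : ℕ → Set
Form = Vec ℤ

infixl 6 _⊞_
infixr 7 _⊠_

_⊞_ : ∀ {n} → Form n → Form n → Form n
_⊞_ = zipWith ℤ._+_

_⊠_ : ∀ {n} → ℤ → Form n → Form n
k ⊠ l = map (k ℤ.*_) l

𝟎 : ∀ {n} → Form n
𝟎 = replicate _ 0ℤ

unit : ∀ {n} → Fin n → Form n
unit zero    = 1ℤ ∷ 𝟎
unit (suc i) = 0ℤ ∷ unit i

dot : ∀ {n} → Form n → Vec ℤ n → ℤ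
dot []      []       = 0ℤ
dot (k ∷ l) (v ∷ vs) = k ℤ.* v ℤ.+ dot l vs

-- Identities of abelian groups are proved by reflection: both sides have the same coefficients.

infixl 6 _:+_ _:-_
infixr 7 _:*_

data Expr (n : ℕ) : Set where
  #_   : Fin n → Expr n
  _:+_ : Expr n → Expr n → Expr n
  :-_  : Expr n → Expr n
  :0   : Expr n
  _:*_ : ℤ → Expr n → Expr n

_:-_ : ∀ {n} → Expr n → Expr n → Expr n
s :- t = s :+ (:- t)

coeffs : ∀ {n} → Expr n → Form n
coeffs (# i)    = unit i
coeffs (s :+ t) = coeffs s ⊞ coeffs t
coeffs (:- s)   = -1ℤ ⊠ coeffs s
coeffs :0       = 𝟎
coeffs (k :* s) = k ⊠ coeffs s

v₀ : ∀ {n} → Expr (1 ℕ.+ n)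
v₀ = # zero
v₁ : ∀ {n} → Expr (2 ℕ.+ n)
v₁ = # (suc zero)
v₂ : ∀ {n} → Expr (3 ℕ.+ n)
v₂ = # (suc (suc zero))
v₃ : ∀ {n} → Expr (4 ℕ.+ n)
v₃ = # (suc (suc (suc zero)))

-- Integer multiples and linear forms over an Abelian ℓ-group.

module LGroup {a} (A : AbelianLGroup a) where
  open AbelianLGroup A public

  abelianGroup : AbelianGroup a a
  abelianGroup = record { isAbelianGroup = isAbelianGroup }

  lattice : Lattice a a
  lattice = record { isLattice = isLattice }

  open AbelianGroup abelianGroup
    using (commutativeMonoid; inverseʳ)
    renaming (identityˡ to +-identityˡ; identityʳ to +-identityʳ; assoc to +-assoc; comm to +-comm)
  open Algebra.Properties.AbelianGroup abelianGroup
    using (⁻¹-involutive; ⁻¹-∙-comm; ε⁻¹≈ε)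
  open Algebra.Properties.CommutativeMonoid.Mult commutativeMonoid
    using (×-homo-+; ×-distrib-+) renaming (_×_ to _×ⁿ_)
  open Relation.Binary.Lattice.Lattice
    (Algebra.Lattice.Properties.Lattice.∨-∧-orderTheoreticLattice lattice) public
    using (_≤_; x≤x∨y; y≤x∨y; ∨-least; x∧y≤x; x∧y≤y; ∧-greatest)
    renaming (refl to ≤-refl; trans to ≤-trans; antisym to ≤-antisym; reflexive to ≤-reflexive)

  infix 30 _⁺
  infixl 6 _-_
  infixr 7 _•_

  _-_ : Carrier → Carrier → Carrier
  x - y = x + (- y)

  _•_ : ℤ → Carrier → Carrier
  + n      • x = n ×ⁿ x
  -[1+ n ] • x = - (suc n ×ⁿ x)

  interchange : ∀ w x y z → (w + x) + (y + z) ≡ (w + y) + (x + z)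
  interchange w x y z = begin
    (w + x) + (y + z) ≡⟨ +-assoc w x (y + z) ⟩
    w + (x + (y + z)) ≡⟨ cong (λ u → w + u) (sym (+-assoc x y z)) ⟩
    w + ((x + y) + z) ≡⟨ cong (λ u → w + (u + z)) (+-comm x y) ⟩
    w + ((y + x) + z) ≡⟨ cong (λ u → w + u) (+-assoc y x z) ⟩
    w + (y + (x + z)) ≡⟨ sym (+-assoc w y (x + z)) ⟩
    (w + y) + (x + z) ∎
    where open ≡-Reasoning

  •-⊖ : ∀ m n x → (m ℤ.⊖ n) • x ≡ (m ×ⁿ x) - (n ×ⁿ x)
  •-⊖ zero    zero    x = sym (inverseʳ 0#)
  •-⊖ zero    (suc n) x = sym (+-identityˡ _)
  •-⊖ (suc m) zero    x = sym (trans (cong (λ u → (suc m ×ⁿ x) + u) ε⁻¹≈ε) (+-identityʳ _))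
  •-⊖ (suc m) (suc n) x = begin
    (suc m ℤ.⊖ suc n) • x               ≡⟨ cong (_• x) (ℤ.[1+m]⊖[1+n]≡m⊖n m n) ⟩
    (m ℤ.⊖ n) • x                       ≡⟨ •-⊖ m n x ⟩
    (m ×ⁿ x) - (n ×ⁿ x)                 ≡⟨ sym (+-identityˡ _) ⟩
    0# + ((m ×ⁿ x) - (n ×ⁿ x))          ≡⟨ cong (_+ ((m ×ⁿ x) - (n ×ⁿ x))) (sym (inverseʳ x)) ⟩
    (x - x) + ((m ×ⁿ x) - (n ×ⁿ x))     ≡⟨ interchange _ _ _ _ ⟩
    (suc m ×ⁿ x) + (- x + - (n ×ⁿ x))   ≡⟨ cong (λ u → (suc m ×ⁿ x) + u) (⁻¹-∙-comm x _) ⟩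
    (suc m ×ⁿ x) - (suc n ×ⁿ x)         ∎
    where open ≡-Reasoning

  •-distribʳ : ∀ i j x → (i ℤ.+ j) • x ≡ i • x + j • x
  •-distribʳ (+ m)    (+ n)    x = ×-homo-+ x m n
  •-distribʳ (+ m)    -[1+ n ] x = •-⊖ m (suc n) x
  •-distribʳ -[1+ m ] (+ n)    x = trans (•-⊖ n (suc m) x) (+-comm _ _)
  •-distribʳ -[1+ m ] -[1+ n ] x = begin
    - (suc (suc (m ℕ.+ n)) ×ⁿ x)      ≡⟨ cong (λ k → - (suc k ×ⁿ x)) (sym (ℕ.+-suc m n)) ⟩
    - ((suc m ℕ.+ suc n) ×ⁿ x)        ≡⟨ cong -_ (×-homo-+ x (suc m) (suc n)) ⟩
    - ((suc m ×ⁿ x) + (suc n ×ⁿ x))   ≡⟨ sym (⁻¹-∙-comm _ _) ⟩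
    - (suc m ×ⁿ x) - (suc n ×ⁿ x)     ∎
    where open ≡-Reasoning

  •-distribˡ : ∀ i x y → i • (x + y) ≡ i • x + i • y
  •-distribˡ (+ m)    x y = ×-distrib-+ x y m
  •-distribˡ -[1+ m ] x y = trans (cong -_ (×-distrib-+ x y (suc m))) (sym (⁻¹-∙-comm _ _))

  •-neg : ∀ i x → (ℤ.- i) • x ≡ - (i • x)
  •-neg (+ zero)  x = sym ε⁻¹≈ε
  •-neg (+ suc n) x = refl
  •-neg -[1+ n ]  x = sym (⁻¹-involutive _)

  •-assoc⁺ : ∀ n j x → ((+ n) ℤ.* j) • x ≡ (+ n) • (j • x)
  •-assoc⁺ zero    j x = cong (_• x) (ℤ.*-zeroˡ j)
  •-assoc⁺ (suc n) j x = begin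
    ((+ suc n) ℤ.* j) • x     ≡⟨ cong (_• x) (ℤ.suc-* (+ n) j) ⟩
    (j ℤ.+ (+ n) ℤ.* j) • x   ≡⟨ •-distribʳ j _ x ⟩
    j • x + ((+ n) ℤ.* j) • x ≡⟨ cong (λ u → j • x + u) (•-assoc⁺ n j x) ⟩
    (+ suc n) • (j • x)       ∎
    where open ≡-Reasoning

  •-assoc : ∀ i j x → (i ℤ.* j) • x ≡ i • (j • x)
  •-assoc (+ n)    j x = •-assoc⁺ n j x
  •-assoc -[1+ n ] j x = begin
    (-[1+ n ] ℤ.* j) • x        ≡⟨ cong (_• x) (sym (ℤ.neg-distribˡ-* (+ suc n) j)) ⟩
    (ℤ.- ((+ suc n) ℤ.* j)) • x ≡⟨ •-neg ((+ suc n) ℤ.* j) x ⟩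
    - (((+ suc n) ℤ.* j) • x)   ≡⟨ cong -_ (•-assoc⁺ (suc n) j x) ⟩
    -[1+ n ] • (j • x)          ∎
    where open ≡-Reasoning

  •-identity : ∀ x → 1ℤ • x ≡ x
  •-identity = +-identityʳ

  •-minus : ∀ x → -1ℤ • x ≡ - x
  •-minus x = cong -_ (•-identity x)

  •-0# : ∀ i → i • 0# ≡ 0#
  •-0# i = begin
    i • 0#           ≡⟨ sym (•-assoc i 0ℤ 0#) ⟩
    (i ℤ.* 0ℤ) • 0#  ≡⟨ cong (_• 0#) (ℤ.*-zeroʳ i) ⟩
    0#               ∎
    where open ≡-Reasoning

  •-comm : ∀ i j x → i • (j • x) ≡ j • (i • x)
  •-comm i j x = begin
    i • (j • x)   ≡⟨ sym (•-assoc i j x) ⟩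
    (i ℤ.* j) • x ≡⟨ cong (_• x) (ℤ.*-comm i j) ⟩
    (j ℤ.* i) • x ≡⟨ •-assoc j i x ⟩
    j • (i • x)   ∎
    where open ≡-Reasoning

  ev : ∀ {n} → Form n → Vec Carrier n → Carrier
  ev []      []       = 0#
  ev (k ∷ l) (x ∷ xs) = k • x + ev l xs

  ev-⊞ : ∀ {n} (l m : Form n) xs → ev (l ⊞ m) xs ≡ ev l xs + ev m xs
  ev-⊞ []      []      []       = sym (+-identityˡ 0#)
  ev-⊞ (j ∷ l) (k ∷ m) (x ∷ xs) =
    trans (cong₂ _+_ (•-distribʳ j k x) (ev-⊞ l m xs)) (interchange _ _ _ _)

  ev-⊠ : ∀ {n} k (l : Form n) xs → ev (k ⊠ l) xs ≡ k • ev l xs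
  ev-⊠ k []      []       = sym (•-0# k)
  ev-⊠ k (j ∷ l) (x ∷ xs) =
    trans (cong₂ _+_ (•-assoc k j x) (ev-⊠ k l xs)) (sym (•-distribˡ k _ _))

  ev-𝟎 : ∀ {n} (xs : Vec Carrier n) → ev 𝟎 xs ≡ 0#
  ev-𝟎 []       = refl
  ev-𝟎 (x ∷ xs) = trans (+-identityˡ _) (ev-𝟎 xs)

  ev-unit : ∀ {n} (i : Fin n) xs → ev (unit i) xs ≡ lookup xs i
  ev-unit zero    (x ∷ xs) = trans (cong₂ _+_ (•-identity x) (ev-𝟎 xs)) (+-identityʳ x)
  ev-unit (suc i) (x ∷ xs) = trans (+-identityˡ _) (ev-unit i xs)

  ev-neg : ∀ {n} (l : Form n) xs → ev (-1ℤ ⊠ l) xs ≡ - ev l xs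
  ev-neg l xs = trans (ev-⊠ -1ℤ l xs) (•-minus _)

  ev-map : ∀ {n} k (l : Form n) xs → ev l (map (k •_) xs) ≡ k • ev l xs
  ev-map k []      []       = sym (•-0# k)
  ev-map k (j ∷ l) (x ∷ xs) =
    trans (cong₂ _+_ (•-comm j k x) (ev-map k l xs)) (sym (•-distribˡ k _ _))

  ev-dot : ∀ {n} (l : Form n) v c → ev l (map (_• c) v) ≡ dot l v • c
  ev-dot []      []       c = refl
  ev-dot (k ∷ l) (i ∷ v) c =
    trans (cong₂ _+_ (sym (•-assoc k i c)) (ev-dot l v c)) (sym (•-distribʳ (k ℤ.* i) _ c))

  ev-++ : ∀ {m n} (l : Form m) (k : Form n) xs ys → ev (l ++ k) (xs ++ ys) ≡ ev l xs + ev k ys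
  ev-++ []      k []       ys = sym (+-identityˡ _)
  ev-++ (j ∷ l) k (x ∷ xs) ys =
    trans (cong (λ u → j • x + u) (ev-++ l k xs ys)) (sym (+-assoc _ _ _))

  ⟦_⟧ᵉ : ∀ {n} → Expr n → Vec Carrier n → Carrier
  ⟦ # i ⟧ᵉ    ρ = lookup ρ i
  ⟦ s :+ t ⟧ᵉ ρ = ⟦ s ⟧ᵉ ρ + ⟦ t ⟧ᵉ ρ
  ⟦ :- s ⟧ᵉ   ρ = - ⟦ s ⟧ᵉ ρ
  ⟦ :0 ⟧ᵉ     ρ = 0#
  ⟦ k :* s ⟧ᵉ ρ = k • ⟦ s ⟧ᵉ ρ

  ev-coeffs : ∀ {n} (s : Expr n) ρ → ev (coeffs s) ρ ≡ ⟦ s ⟧ᵉ ρ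
  ev-coeffs (# i)    ρ = ev-unit i ρ
  ev-coeffs (s :+ t) ρ = trans (ev-⊞ (coeffs s) (coeffs t) ρ) (cong₂ _+_ (ev-coeffs s ρ) (ev-coeffs t ρ))
  ev-coeffs (:- s)   ρ = trans (ev-neg (coeffs s) ρ) (cong -_ (ev-coeffs s ρ))
  ev-coeffs :0       ρ = ev-𝟎 ρ
  ev-coeffs (k :* s) ρ = trans (ev-⊠ k (coeffs s) ρ) (cong (k •_) (ev-coeffs s ρ))

  solve : ∀ {n} (ρ : Vec Carrier n) (s t : Expr n) → coeffs s ≡ coeffs t → ⟦ s ⟧ᵉ ρ ≡ ⟦ t ⟧ᵉ ρ
  solve ρ s t eq = trans (sym (ev-coeffs s ρ)) (trans (cong (λ l → ev l ρ) eq) (ev-coeffs t ρ))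

  -- The lattice order and the orthogonality of positive and negative parts.

  ≤-resp : ∀ {x x′ y y′} → x ≡ x′ → y ≡ y′ → x ≤ y → x′ ≤ y′
  ≤-resp refl refl p = p

  +-monoʳ : ∀ z {x y} → x ≤ y → z + x ≤ z + y
  +-monoʳ z {x} {y} x≤y =
    subst (z + x ≤_)
      (trans (sym (+-distrib-∨ z x y)) (cong (λ u → z + u) (≤-antisym (∨-least x≤y ≤-refl) (y≤x∨y x y))))
      (x≤x∨y (z + x) (z + y))

  +-mono : ∀ {w x y z} → w ≤ x → y ≤ z → w + y ≤ x + z
  +-mono {w} {x} {y} {z} p q =
    ≤-trans (+-monoʳ w q) (≤-resp (+-comm z w) (+-comm z x) (+-monoʳ z p))

  x≤y⇒x-y≤0 : ∀ {x y} → x ≤ y → x - y ≤ 0#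
  x≤y⇒x-y≤0 {x} {y} p = ≤-resp refl (inverseʳ y) (+-mono p ≤-refl)

  x-y≤0⇒x≤y : ∀ {x y} → x - y ≤ 0# → x ≤ y
  x-y≤0⇒x≤y {x} {y} p =
    ≤-resp (solve (x ∷ y ∷ []) (v₀ :- v₁ :+ v₁) v₀ refl) (+-identityˡ y) (+-mono p ≤-refl)

  •-mono : ∀ n {x y} → x ≤ y → (+ n) • x ≤ (+ n) • y
  •-mono zero    p = ≤-refl
  •-mono (suc n) p = +-mono p (•-mono n p)

  •-nonneg : ∀ n {x} → 0# ≤ x → 0# ≤ (+ n) • x
  •-nonneg n p = ≤-resp (•-0# (+ n)) refl (•-mono n p)

  -- Let `t` be the meet of `u` and `v + w`. Then `t - w` lies below both `u` and `v`, so `t ≤ w`;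
  -- being also below `u`, `t` lies below `u ∧ w`.
  ∧-orth-+ : ∀ {u v w} → 0# ≤ w → u ∧ v ≤ 0# → u ∧ w ≤ 0# → u ∧ (v + w) ≤ 0#
  ∧-orth-+ {u} {v} {w} 0≤w uv uw = ≤-trans (∧-greatest (x∧y≤x u _) t≤w) uw
    where
    t = u ∧ (v + w)
    cancel-w : ∀ {x} → t ≤ x + w → t - w ≤ x
    cancel-w {x} p = ≤-resp refl (solve (x ∷ w ∷ []) (v₀ :+ v₁ :- v₁) v₀ refl) (+-mono p ≤-refl)
    t≤u+w : t ≤ u + w
    t≤u+w = ≤-resp (+-identityʳ t) refl (+-mono (x∧y≤x u _) 0≤w)
    t≤w : t ≤ w
    t≤w = x-y≤0⇒x≤y (≤-trans (∧-greatest (cancel-w t≤u+w) (cancel-w (x∧y≤y u _))) uv)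

  ∧-orth-• : ∀ n {u v} → 0# ≤ v → u ∧ v ≤ 0# → u ∧ ((+ n) • v) ≤ 0#
  ∧-orth-• zero    0≤v p = x∧y≤y _ _
  ∧-orth-• (suc n) 0≤v p = ∧-orth-+ (•-nonneg n 0≤v) p (∧-orth-• n 0≤v p)

  ∧-swap : ∀ {u v} → u ∧ v ≤ 0# → v ∧ u ≤ 0#
  ∧-swap p = ≤-trans (∧-greatest (x∧y≤y _ _) (x∧y≤x _ _)) p

  _⁺ : Carrier → Carrier
  x ⁺ = x ∨ 0#

  ⁺-nonneg : ∀ x → 0# ≤ x ⁺
  ⁺-nonneg x = y≤x∨y x 0#

  x≤x⁺ : ∀ x → x ≤ x ⁺
  x≤x⁺ x = x≤x∨y x 0#

  ⁺-decomp : ∀ x → x ⁺ ≡ x + ((- x) ⁺)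
  ⁺-decomp x = sym (begin
    x + ((- x) ∨ 0#)      ≡⟨ +-distrib-∨ x (- x) 0# ⟩
    (x - x) ∨ (x + 0#)    ≡⟨ cong₂ _∨_ (inverseʳ x) (+-identityʳ x) ⟩
    0# ∨ x                ≡⟨ ≤-antisym (∨-least (y≤x∨y _ _) (x≤x∨y _ _)) (∨-least (y≤x∨y _ _) (x≤x∨y _ _)) ⟩
    x ∨ 0#                ∎)
    where open ≡-Reasoning

  -- With `s` the negative part and `t` the meet, `t` is below `x + s` and below `s`. So `s - t`
  -- bounds both `- x` and 0 from above, hence also their join `s`.
  ⁺-orth : ∀ x → x ⁺ ∧ (- x) ⁺ ≤ 0#
  ⁺-orth x = ≤-resp (solve (s ∷ t ∷ []) (v₀ :+ (v₁ :- v₀)) v₁ refl)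
                    (solve (s ∷ t ∷ []) ((v₀ :- v₁) :+ (v₁ :- v₀)) :0 refl) (+-mono s≤s-t ≤-refl)
    where
    s = (- x) ⁺
    t = x ⁺ ∧ s
    t≤x+s : t ≤ x + s
    t≤x+s = ≤-trans (x∧y≤x _ _) (≤-reflexive (⁺-decomp x))
    s≤s-t : s ≤ s - t
    s≤s-t = ∨-least
      (≤-resp (solve (x ∷ s ∷ t ∷ []) (v₂ :+ (:- v₀ :- v₂)) (:- v₀) refl)
              (solve (x ∷ s ∷ t ∷ []) (v₀ :+ v₁ :+ (:- v₀ :- v₂)) (v₁ :- v₂) refl) (+-mono t≤x+s ≤-refl))
      (≤-resp (inverseʳ t) refl (+-mono (x∧y≤y _ s) ≤-refl))

  -- The positive part `u` satisfies `u ≤ (n + 1) u = (n + 1) x + (n + 1) w ≤ (n + 1)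
  -- w`, where `w` is the negative part; but `u` is orthogonal to all multiples of `w`.
  -- Torsion-freeness follows.
  •-cancel-≤0 : ∀ n {x} → (+ suc n) • x ≤ 0# → x ≤ 0#
  •-cancel-≤0 n {x} p = ≤-trans (x≤x⁺ x) (≤-trans (∧-greatest ≤-refl u≤kw) (∧-orth-• (suc n) (⁺-nonneg _) (⁺-orth x)))
    where
    u = x ⁺
    w = (- x) ⁺
    u≤kw : u ≤ (+ suc n) • w
    u≤kw = ≤-trans (≤-resp (+-identityʳ u) refl (+-monoʳ u (•-nonneg n (⁺-nonneg x))))
      (≤-resp (trans (sym (•-distribˡ (+ suc n) x w)) (cong ((+ suc n) •_) (sym (⁺-decomp x))))
              (+-identityˡ _) (+-mono p ≤-refl))

-- Order modulo the convex subgroup generated by h ≥ 0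

module Modulo {a} (A : AbelianLGroup a) where
  open LGroup A public

  -- For `h ≥ 0` this is `x ≤ 0` in the quotient by the convex subgroup generated by `h`. Quotients
  -- are never built: varying `h` replaces passing to them, while carrier and equality stay fixed.
  Neg : Carrier → Carrier → Set a
  Neg h x = Σ ℕ λ n → x ≤ (+ n) • h

  infix 4 _≈[_]_
  _≈[_]_ : Carrier → Carrier → Carrier → Set a
  x ≈[ h ] y = Neg h (x - y) × Neg h (y - x)

  ≤-move : ∀ {x y x′ y′} → x ≤ y → x - y ≡ x′ - y′ → x′ ≤ y′
  ≤-move p eq = x-y≤0⇒x≤y (≤-trans (≤-reflexive (sym eq)) (x≤y⇒x-y≤0 p))

  x≤x+y : ∀ {x y} → 0# ≤ y → x ≤ x + y
  x≤x+y {x} {y} p = ≤-move p (solve (x ∷ y ∷ []) (:0 :- v₁) (v₀ :- (v₀ :+ v₁)) refl)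

  x≤y+x : ∀ {x y} → 0# ≤ y → x ≤ y + x
  x≤y+x {x} {y} p = ≤-move p (solve (x ∷ y ∷ []) (:0 :- v₁) (v₀ :- (v₁ :+ v₀)) refl)

  +-nonneg : ∀ {x y} → 0# ≤ x → 0# ≤ y → 0# ≤ x + y
  +-nonneg p q = ≤-trans p (x≤x+y q)

  ≤0⇒Neg : ∀ {h x} → x ≤ 0# → Neg h x
  ≤0⇒Neg p = 0 , p

  Neg⇒≤0 : ∀ {x} → Neg 0# x → x ≤ 0#
  Neg⇒≤0 (n , p) = ≤-trans p (≤-reflexive (•-0# (+ n)))

  Neg-self : ∀ {h} → Neg h h
  Neg-self {h} = 1 , ≤-reflexive (sym (•-identity h))

  Neg-≤ : ∀ {h x y} → x ≤ y → Neg h y → Neg h x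
  Neg-≤ p (n , q) = n , ≤-trans p q

  Neg-≡ : ∀ {h x y} → y ≡ x → Neg h y → Neg h x
  Neg-≡ refl q = q

  Neg-+ : ∀ {h x y} → Neg h x → Neg h y → Neg h (x + y)
  Neg-+ {h} (m , p) (n , q) =
    m ℕ.+ n , ≤-trans (+-mono p q) (≤-reflexive (sym (•-distribʳ (+ m) (+ n) h)))

  Neg-• : ∀ {h x} n → Neg h x → Neg h ((+ n) • x)
  Neg-• zero    p = 0 , ≤-refl
  Neg-• (suc n) p = Neg-+ p (Neg-• n p)

  Neg-weaken : ∀ {h k x} → h ≤ k → Neg h x → Neg k x
  Neg-weaken h≤k (n , p) = n , ≤-trans p (•-mono n h≤k)

  -- The bound `m h` is first enlarged to `(n + 1) m h`, so that `•-cancel-≤0` applies to `x - m h`.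
  Neg-cancel : ∀ {h x} n → 0# ≤ h → Neg h ((+ suc n) • x) → Neg h x
  Neg-cancel {h} {x} n 0≤h (m , p) = m , x-y≤0⇒x≤y (•-cancel-≤0 n
    (≤-trans (≤-reflexive (trans (•-distribˡ (+ suc n) x (- ((+ m) • h))) (cong (λ u → (+ suc n) • x + u) minus)))
             (x≤y⇒x-y≤0 (≤-trans p (x≤x+y (•-nonneg n (•-nonneg m 0≤h)))))))
    where
    k = (+ m) • h
    minus : (+ suc n) • (- k) ≡ - ((+ suc n) • k)
    minus = trans (cong ((+ suc n) •_) (sym (•-minus k))) (trans (•-comm (+ suc n) -1ℤ k) (•-minus _))

  •-mono-ℕ : ∀ {m n h} → 0# ≤ h → m ℕ.≤ n → (+ m) • h ≤ (+ n) • h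
  •-mono-ℕ {n = n} 0≤h z≤n       = •-nonneg n 0≤h
  •-mono-ℕ         0≤h (s≤s m≤n) = +-mono ≤-refl (•-mono-ℕ 0≤h m≤n)

  Neg-common : ∀ {h x y} → 0# ≤ h → Neg h x → Neg h y →
    Σ ℕ λ n → (x ≤ (+ n) • h) × (y ≤ (+ n) • h)
  Neg-common 0≤h (m , p) (n , q) =
    m ℕ.+ n , ≤-trans p (•-mono-ℕ 0≤h (ℕ.m≤m+n m n)) , ≤-trans q (•-mono-ℕ 0≤h (ℕ.m≤n+m n m))

  Neg-∨ : ∀ {h x y w} → 0# ≤ h → Neg h (x - w) → Neg h (y - w) → Neg h ((x ∨ y) - w)
  Neg-∨ {h} {x} {y} {w} 0≤h p q with Neg-common 0≤h p q
  ... | n , p′ , q′ = n , ≤-move (∨-least (move p′) (move q′))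
        (solve (x ∨ y ∷ w ∷ k ∷ []) (v₀ :- (v₂ :+ v₁)) ((v₀ :- v₁) :- v₂) refl)
    where
    k = (+ n) • h
    move : ∀ {z} → z - w ≤ k → z ≤ k + w
    move {z} r = ≤-move r (solve (z ∷ w ∷ k ∷ []) ((v₀ :- v₁) :- v₂) (v₀ :- (v₂ :+ v₁)) refl)

  Neg-∧ : ∀ {h x y w} → 0# ≤ h → Neg h (w - x) → Neg h (w - y) → Neg h (w - (x ∧ y))
  Neg-∧ {h} {x} {y} {w} 0≤h p q with Neg-common 0≤h p q
  ... | n , p′ , q′ = n , ≤-move (∧-greatest (move p′) (move q′))
        (solve (x ∧ y ∷ w ∷ k ∷ []) ((v₁ :- v₂) :- v₀) ((v₁ :- v₀) :- v₂) refl)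
    where
    k = (+ n) • h
    move : ∀ {z} → w - z ≤ k → w - k ≤ z
    move {z} r = ≤-move r (solve (z ∷ w ∷ k ∷ []) ((v₁ :- v₀) :- v₂) ((v₁ :- v₂) :- v₀) refl)

  -- The polars of a⁺ and a⁻ meet in 0, so a fact may be proved separately in the two
  -- quotients where a ≤ 0 and where a ≥ 0, as if the ℓ-group were a chain.
  Neg-split : ∀ {h} a {x} → 0# ≤ h → Neg (h + a ⁺) x → Neg (h + (- a) ⁺) x → Neg h x
  Neg-split {h} a {x} 0≤h (m , p) (n , q) = N , x-y≤0⇒x≤y
    -- `x - N h` lies below both `N a⁺` and `N a⁻`, and multiples of orthogonal elements stay
    -- orthogonal.
    (≤-trans (∧-greatest (below m≤N (⁺-nonneg a) p) (below n≤N (⁺-nonneg (- a)) q))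
             (∧-orth-• N (⁺-nonneg _) (∧-swap (∧-orth-• N (⁺-nonneg _) (∧-swap (⁺-orth a))))))
    where
    N = m ℕ.+ n
    m≤N = ℕ.m≤m+n m n
    n≤N = ℕ.m≤n+m n m
    below : ∀ {k u} → k ℕ.≤ N → 0# ≤ u → x ≤ (+ k) • (h + u) → x - ((+ N) • h) ≤ (+ N) • u
    below {k} {u} k≤N 0≤u r =
      ≤-move (≤-trans (≤-trans r (•-mono-ℕ (+-nonneg 0≤h 0≤u) k≤N)) (≤-reflexive (•-distribˡ (+ N) h u)))
        (solve (x ∷ (+ N) • h ∷ (+ N) • u ∷ []) (v₀ :- (v₁ :+ v₂)) ((v₀ :- v₁) :- v₂) refl)

  Neg-⁺ : ∀ {h} a → 0# ≤ h → Neg (h + a ⁺) a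
  Neg-⁺ a 0≤h = Neg-≤ (≤-trans (x≤x⁺ a) (x≤y+x 0≤h)) Neg-self

  ≈-refl : ∀ {h x} → x ≈[ h ] x
  ≈-refl = ≤0⇒Neg (x≤y⇒x-y≤0 ≤-refl) , ≤0⇒Neg (x≤y⇒x-y≤0 ≤-refl)

  ≈-sym : ∀ {h x y} → x ≈[ h ] y → y ≈[ h ] x
  ≈-sym (p , q) = q , p

  ≈-≡ : ∀ {h x y} → x ≡ y → x ≈[ h ] y
  ≈-≡ refl = ≈-refl

  Neg-trans : ∀ {h x y z} → Neg h (x - y) → Neg h (y - z) → Neg h (x - z)
  Neg-trans {h} {x} {y} {z} p q =
    Neg-≡ (solve (x ∷ y ∷ z ∷ []) ((v₀ :- v₁) :+ (v₁ :- v₂)) (v₀ :- v₂) refl) (Neg-+ p q)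

  ≈-trans : ∀ {h x y z} → x ≈[ h ] y → y ≈[ h ] z → x ≈[ h ] z
  ≈-trans (p , p′) (q , q′) = Neg-trans p q , Neg-trans q′ p′

  ≈-weaken : ∀ {h k x y} → h ≤ k → x ≈[ h ] y → x ≈[ k ] y
  ≈-weaken h≤k (p , q) = Neg-weaken h≤k p , Neg-weaken h≤k q

  ≈⇒≡ : ∀ {x y} → x ≈[ 0# ] y → x ≡ y
  ≈⇒≡ (p , q) = ≤-antisym (x-y≤0⇒x≤y (Neg⇒≤0 p)) (x-y≤0⇒x≤y (Neg⇒≤0 q))

  ≈-split : ∀ {h} a {x y} → 0# ≤ h → x ≈[ h + a ⁺ ] y → x ≈[ h + (- a) ⁺ ] y → x ≈[ h ] y
  ≈-split a 0≤h (p , q) (p′ , q′) = Neg-split a 0≤h p p′ , Neg-split a 0≤h q q′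

  ≈-+ : ∀ {h x x′ y y′} → x ≈[ h ] x′ → y ≈[ h ] y′ → x + y ≈[ h ] x′ + y′
  ≈-+ {h} (p , p′) (q , q′) = move p q , move p′ q′
    where
    move : ∀ {x x′ y y′} → Neg h (x - x′) → Neg h (y - y′) → Neg h ((x + y) - (x′ + y′))
    move {x} {x′} {y} {y′} p q = Neg-≡
      (solve (x ∷ x′ ∷ y ∷ y′ ∷ []) ((v₀ :- v₁) :+ (v₂ :- v₃)) ((v₀ :+ v₂) :- (v₁ :+ v₃)) refl) (Neg-+ p q)

  ≈-neg : ∀ {h x y} → x ≈[ h ] y → - x ≈[ h ] - y
  ≈-neg {x = x} {y} (p , q) =
    Neg-≡ (solve (x ∷ y ∷ []) (v₁ :- v₀) (:- v₀ :- :- v₁) refl) q ,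
    Neg-≡ (solve (x ∷ y ∷ []) (v₀ :- v₁) (:- v₁ :- :- v₀) refl) p

  ≈-∨-right : ∀ {h s t v w} → 0# ≤ h → s ≈[ h ] v → t ≈[ h ] w → Neg h (v - w) → (s ∨ t) ≈[ h ] w
  ≈-∨-right {s = s} {t} 0≤h (p , _) (q , q′) r =
    Neg-∨ 0≤h (Neg-trans p r) q ,
    Neg-trans q′ (≤0⇒Neg (x≤y⇒x-y≤0 (y≤x∨y s t)))

  ≈-∧-right : ∀ {h s t v w} → 0# ≤ h → s ≈[ h ] v → t ≈[ h ] w → Neg h (w - v) → (s ∧ t) ≈[ h ] w
  ≈-∧-right {s = s} {t} 0≤h (_ , p′) (q , q′) r =
    Neg-trans (≤0⇒Neg (x≤y⇒x-y≤0 (x∧y≤y s t))) q ,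
    Neg-∧ 0≤h (Neg-trans r p′) q′

  ∨-comm : ∀ s t → s ∨ t ≡ t ∨ s
  ∨-comm s t = ≤-antisym (∨-least (y≤x∨y t s) (x≤x∨y t s)) (∨-least (y≤x∨y s t) (x≤x∨y s t))

  ∧-comm : ∀ s t → s ∧ t ≡ t ∧ s
  ∧-comm s t = ≤-antisym (∧-greatest (x∧y≤y s t) (x∧y≤x s t)) (∧-greatest (x∧y≤y t s) (x∧y≤x t s))

  ≈-∧-left : ∀ {h s t v w} → 0# ≤ h → s ≈[ h ] v → t ≈[ h ] w → Neg h (v - w) → (s ∧ t) ≈[ h ] v
  ≈-∧-left {s = s} {t} 0≤h p q r = ≈-trans (≈-≡ (∧-comm s t)) (≈-∧-right 0≤h q p r)

  ≈-∨ : ∀ {h s s′ t t′} → 0# ≤ h → s ≈[ h ] s′ → t ≈[ h ] t′ → (s ∨ t) ≈[ h ] (s′ ∨ t′)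
  ≈-∨ {h} 0≤h (p , p′) (q , q′) = half p q , half p′ q′
    where
    half : ∀ {s s′ t t′} → Neg h (s - s′) → Neg h (t - t′) → Neg h ((s ∨ t) - (s′ ∨ t′))
    half {s} {s′} {t} {t′} p q =
      Neg-∨ 0≤h (Neg-trans p (≤0⇒Neg (x≤y⇒x-y≤0 (x≤x∨y s′ t′)))) (Neg-trans q (≤0⇒Neg (x≤y⇒x-y≤0 (y≤x∨y s′ t′))))

  ≈-∧ : ∀ {h s s′ t t′} → 0# ≤ h → s ≈[ h ] s′ → t ≈[ h ] t′ → (s ∧ t) ≈[ h ] (s′ ∧ t′)
  ≈-∧ {h} 0≤h (p , p′) (q , q′) = half p q , half p′ q′
    where
    half : ∀ {s s′ t t′} → Neg h (s - s′) → Neg h (t - t′) → Neg h ((s ∧ t) - (s′ ∧ t′))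
    half {s} {s′} {t} {t′} p q =
      Neg-∧ 0≤h (Neg-trans (≤0⇒Neg (x≤y⇒x-y≤0 (x∧y≤x s t))) p) (Neg-trans (≤0⇒Neg (x≤y⇒x-y≤0 (x∧y≤y s t))) q)

  -- Chinese remainder theorem for A/⟨p⟩ and A/⟨q⟩.
  glue : ∀ {p q x y} → 0# ≤ p → 0# ≤ q → x ≈[ p + q ] y →
    Σ Carrier λ z → (z ≈[ p ] x) × (z ≈[ q ] y)
  glue {p} {q} {x} {y} 0≤p 0≤q (xy , yx) with Neg-common (+-nonneg 0≤p 0≤q) xy yx
  ... | n , x-y≤ , y-x≤ = z , ((n , z-x≤P) , (n , x-z≤P)) , ((n , z-y≤Q) , (n , y-z≤Q))
    where
    P = (+ n) • p
    Q = (+ n) • q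
    -- `y` is truncated to the interval from `x - P` to `x + P`; since `y` is within `P + Q` of `x`,
    -- truncation moves it by at most `Q`.
    z = (y ∨ (x - P)) ∧ (x + P)
    0≤P = •-nonneg n 0≤p
    0≤Q = •-nonneg n 0≤q
    split : (+ n) • (p + q) ≡ P + Q
    split = •-distribˡ (+ n) p q
    x-P≤x+P : x - P ≤ x + P
    x-P≤x+P = ≤-move (+-nonneg 0≤P 0≤P) (solve (x ∷ P ∷ []) (:0 :- (v₁ :+ v₁)) ((v₀ :- v₁) :- (v₀ :+ v₁)) refl)
    z-x≤P : z - x ≤ P
    z-x≤P = ≤-move (x∧y≤y (y ∨ (x - P)) (x + P))
      (solve (z ∷ x ∷ P ∷ []) (v₀ :- (v₁ :+ v₂)) ((v₀ :- v₁) :- v₂) refl)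
    x-z≤P : x - z ≤ P
    x-z≤P = ≤-move (∧-greatest (y≤x∨y y (x - P)) x-P≤x+P)
      (solve (z ∷ x ∷ P ∷ []) ((v₁ :- v₂) :- v₀) ((v₁ :- v₀) :- v₂) refl)
    x-P≤y+Q : x - P ≤ y + Q
    x-P≤y+Q = ≤-move (≤-trans x-y≤ (≤-reflexive split))
      (solve (x ∷ y ∷ P ∷ Q ∷ []) ((v₀ :- v₁) :- (v₂ :+ v₃)) ((v₀ :- v₂) :- (v₁ :+ v₃)) refl)
    y-Q≤x+P : y - Q ≤ x + P
    y-Q≤x+P = ≤-move (≤-trans y-x≤ (≤-reflexive split))
      (solve (x ∷ y ∷ P ∷ Q ∷ []) ((v₁ :- v₀) :- (v₂ :+ v₃)) ((v₁ :- v₃) :- (v₀ :+ v₂)) refl)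
    y-Q≤y : y - Q ≤ y
    y-Q≤y = ≤-move 0≤Q (solve (y ∷ Q ∷ []) (:0 :- v₁) ((v₀ :- v₁) :- v₀) refl)
    z-y≤Q : z - y ≤ Q
    z-y≤Q = ≤-move (≤-trans (x∧y≤x (y ∨ (x - P)) (x + P)) (∨-least (x≤x+y 0≤Q) x-P≤y+Q))
      (solve (z ∷ y ∷ Q ∷ []) (v₀ :- (v₁ :+ v₂)) ((v₀ :- v₁) :- v₂) refl)
    y-z≤Q : y - z ≤ Q
    y-z≤Q = ≤-move (∧-greatest (≤-trans y-Q≤y (x≤x∨y y (x - P))) y-Q≤x+P)
      (solve (z ∷ y ∷ Q ∷ []) ((v₁ :- v₂) :- v₀) ((v₁ :- v₀) :- v₂) refl)

-- Terms as piecewise linear functions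

infixl 6 _⊟_

_⊟_ : ∀ {n} → Form n → Form n → Form n
l ⊟ m = l ⊞ (-1ℤ ⊠ m)

-- A piece of a piecewise linear function: the forms required to be ≤ 0, and the value there.
Piece : ℕ → Set
Piece n = List (Form n) × Form n

lower upper : ∀ {n} → Piece n → Piece n → Piece n
lower (c , v) (d , w) = (v ⊟ w) ∷ (c ++ᴸ d) , v
upper (c , v) (d , w) = (v ⊟ w) ∷ (c ++ᴸ d) , w

Eqs : ℕ → Set
Eqs n = List (Term n × Term n)

module Pieces {m n} (σ : Fin m → Form n) where

  plus : Piece n → Piece n → Piece n
  plus (c , v) (d , w) = c ++ᴸ d , v ⊞ w

  minus : Piece n → Piece n
  minus (c , v) = c , -1ℤ ⊠ v

  pieces : Term m → List (Piece n)
  pieces (var i) = ([] , σ i) ∷ []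
  pieces (s ⊕ t) = cartesianProductWith plus (pieces s) (pieces t)
  pieces (⊖ t)   = mapᴸ minus (pieces t)
  pieces 𝟘       = ([] , 𝟎) ∷ []
  pieces (s ⊻ t) = cartesianProductWith upper (pieces s) (pieces t) ++ᴸ
                   cartesianProductWith upper (pieces t) (pieces s)
  pieces (s ⊼ t) = cartesianProductWith lower (pieces s) (pieces t) ++ᴸ
                   cartesianProductWith lower (pieces t) (pieces s)

  agree : Piece n → Piece n → List (Form n)
  agree (c , v) (d , w) = (v ⊟ w) ∷ (w ⊟ v) ∷ (c ++ᴸ d)

  cones : Eqs m → List (List (Form n))
  cones []             = [] ∷ []
  cones ((s , t) ∷ es) = cartesianProductWith _++ᴸ_ (cartesianProductWith agree (pieces s) (pieces t)) (cones es)

module Semantics {a} (A : AbelianLGroup a) where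
  open Modulo A public

  ev-⊟ : ∀ {n} (l m : Form n) ρ → ev (l ⊟ m) ρ ≡ ev l ρ - ev m ρ
  ev-⊟ l m ρ = trans (ev-⊞ l _ ρ) (cong (λ u → ev l ρ + u) (ev-neg m ρ))

  Below : ∀ {n} → Carrier → Vec Carrier n → List (Form n) → Set a
  Below h ρ = All (λ l → Neg h (ev l ρ))

  Below-weaken : ∀ {n h k} {ρ : Vec Carrier n} {c} → h ≤ k → Below h ρ c → Below k ρ c
  Below-weaken h≤k = All.map (Neg-weaken h≤k)

  Holds : ∀ {m} → Carrier → Vec Carrier m → Eqs m → Set a
  Holds h ρ = All (λ e → ⟦ A ⟧ (proj₁ e) ρ ≈[ h ] ⟦ A ⟧ (proj₂ e) ρ)

  ⟦⟧-cong : ∀ {m h} (t : Term m) {ρ τ : Vec Carrier m} → 0# ≤ h →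
    (∀ i → lookup ρ i ≈[ h ] lookup τ i) → ⟦ A ⟧ t ρ ≈[ h ] ⟦ A ⟧ t τ
  ⟦⟧-cong (var i) 0≤h eq = eq i
  ⟦⟧-cong (s ⊕ t) 0≤h eq = ≈-+ (⟦⟧-cong s 0≤h eq) (⟦⟧-cong t 0≤h eq)
  ⟦⟧-cong (⊖ t)   0≤h eq = ≈-neg (⟦⟧-cong t 0≤h eq)
  ⟦⟧-cong 𝟘       0≤h eq = ≈-refl
  ⟦⟧-cong (s ⊻ t) 0≤h eq = ≈-∨ 0≤h (⟦⟧-cong s 0≤h eq) (⟦⟧-cong t 0≤h eq)
  ⟦⟧-cong (s ⊼ t) 0≤h eq = ≈-∧ 0≤h (⟦⟧-cong s 0≤h eq) (⟦⟧-cong t 0≤h eq)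

  Holds-cong : ∀ {m h es} {ρ τ : Vec Carrier m} → 0# ≤ h →
    (∀ i → lookup ρ i ≈[ h ] lookup τ i) → Holds h ρ es → Holds h τ es
  Holds-cong {ρ = ρ} {τ} 0≤h eq = All.map λ { {s , t} p →
    ≈-trans (≈-sym (⟦⟧-cong s {ρ} {τ} 0≤h eq)) (≈-trans p (⟦⟧-cong t {ρ} {τ} 0≤h eq)) }

  Holds-weaken : ∀ {m h k es} {ρ : Vec Carrier m} → h ≤ k → Holds h ρ es → Holds k ρ es
  Holds-weaken h≤k = All.map (≈-weaken h≤k)

  Holds-split : ∀ {m h} {ρ : Vec Carrier m} {es} a → 0# ≤ h →
    Holds (h + a ⁺) ρ es → Holds (h + (- a) ⁺) ρ es → Holds h ρ es
  Holds-split a 0≤h []       []       = []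
  Holds-split a 0≤h (p ∷ ps) (q ∷ qs) = ≈-split a 0≤h p q ∷ Holds-split a 0≤h ps qs

  -- Without a linear order a point need not lie in any one cone of `C`. Covering is therefore
  -- stated by its use: to prove `Neg h g` one may enlarge `h` until the point lies in some cone.
  Covers : ∀ {n} → Carrier → Vec Carrier n → Carrier → List (List (Form n)) → Set a
  Covers {n} h ρ g C = (∀ {c k} → c ∈ C → h ≤ k → Below k ρ c → Neg k g) → Neg h g

  module _ {m n} (σ : Fin m → Form n) {τ : Vec Carrier m} {ρ : Vec Carrier n}
           (σ-ok : ∀ i → ev (σ i) ρ ≡ lookup τ i) where
    open Pieces σ

    PieceCover : Carrier → Carrier → List (Piece n) → Set a
    PieceCover h g ps = (∀ {p k} → p ∈ ps → h ≤ k → Below k ρ (proj₁ p) → Neg k g) → Neg h g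

    pieces-sound : ∀ {h} → 0# ≤ h → ∀ t {p} → p ∈ pieces t → Below h ρ (proj₁ p) →
      ⟦ A ⟧ t τ ≈[ h ] ev (proj₂ p) ρ

    upper-sound : ∀ {h} → 0# ≤ h → ∀ s t {r} → r ∈ cartesianProductWith upper (pieces s) (pieces t) →
      Below h ρ (proj₁ r) → (⟦ A ⟧ s τ ∨ ⟦ A ⟧ t τ) ≈[ h ] ev (proj₂ r) ρ
    upper-sound 0≤h s t r∈ b with ∈-cartesianProductWith⁻ upper (pieces s) (pieces t) r∈
    upper-sound 0≤h s t r∈ (b ∷ bs) | (c , v) , (d , w) , p∈ , q∈ , refl =
      ≈-∨-right 0≤h (pieces-sound 0≤h s p∈ (++⁻ˡ c bs)) (pieces-sound 0≤h t q∈ (++⁻ʳ c bs))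
        (Neg-≡ (ev-⊟ v w ρ) b)

    lower-sound : ∀ {h} → 0# ≤ h → ∀ s t {r} → r ∈ cartesianProductWith lower (pieces s) (pieces t) →
      Below h ρ (proj₁ r) → (⟦ A ⟧ s τ ∧ ⟦ A ⟧ t τ) ≈[ h ] ev (proj₂ r) ρ
    lower-sound 0≤h s t r∈ b with ∈-cartesianProductWith⁻ lower (pieces s) (pieces t) r∈
    lower-sound 0≤h s t r∈ (b ∷ bs) | (c , v) , (d , w) , p∈ , q∈ , refl =
      ≈-∧-left 0≤h (pieces-sound 0≤h s p∈ (++⁻ˡ c bs)) (pieces-sound 0≤h t q∈ (++⁻ʳ c bs))
        (Neg-≡ (ev-⊟ v w ρ) b)

    pieces-sound 0≤h (var i) (here refl) b = ≈-≡ (sym (σ-ok i))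
    pieces-sound 0≤h (s ⊕ t) r∈ b with ∈-cartesianProductWith⁻ plus (pieces s) (pieces t) r∈
    ... | (c , v) , (d , w) , p∈ , q∈ , refl =
      ≈-trans (≈-+ (pieces-sound 0≤h s p∈ (++⁻ˡ c b)) (pieces-sound 0≤h t q∈ (++⁻ʳ c b)))
              (≈-≡ (sym (ev-⊞ v w ρ)))
    pieces-sound 0≤h (⊖ t) r∈ b with ∈-map⁻ minus r∈
    ... | (c , v) , p∈ , refl = ≈-trans (≈-neg (pieces-sound 0≤h t p∈ b)) (≈-≡ (sym (ev-neg v ρ)))
    pieces-sound 0≤h 𝟘 (here refl) b = ≈-≡ (sym (ev-𝟎 ρ))
    pieces-sound 0≤h (s ⊻ t) r∈ b with ∈-++⁻ (cartesianProductWith upper (pieces s) (pieces t)) r∈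
    ... | inj₁ r∈′ = upper-sound 0≤h s t r∈′ b
    ... | inj₂ r∈′ = ≈-trans (≈-≡ (∨-comm _ _)) (upper-sound 0≤h t s r∈′ b)
    pieces-sound 0≤h (s ⊼ t) r∈ b with ∈-++⁻ (cartesianProductWith lower (pieces s) (pieces t)) r∈
    ... | inj₁ r∈′ = lower-sound 0≤h s t r∈′ b
    ... | inj₂ r∈′ = ≈-trans (≈-≡ (∧-comm _ _)) (lower-sound 0≤h t s r∈′ b)

    pair-cover : ∀ {h g ps qs} →
      (∀ {h g} → 0# ≤ h → PieceCover h g ps) → (∀ {h g} → 0# ≤ h → PieceCover h g qs) → 0# ≤ h →
      (∀ {p q k} → p ∈ ps → q ∈ qs → h ≤ k → Below k ρ (proj₁ p) → Below k ρ (proj₁ q) → Neg k g) →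
      Neg h g
    pair-cover P Q 0≤h K = P 0≤h λ p∈ h≤k bp → Q (≤-trans 0≤h h≤k) λ q∈ k≤k′ bq →
      K p∈ q∈ (≤-trans h≤k k≤k′) (Below-weaken k≤k′ bp) bq

    -- `Neg-split` at the difference of the two values leads to `f p q` where the first value is the
    -- smaller one and to `f q p` where the second is. Joins and meets impose the same conditions
    -- and share the argument.
    compare-cover : ∀ {h g ps qs} (f : Piece n → Piece n → Piece n) →
      (∀ p q → proj₁ (f p q) ≡ (proj₂ p ⊟ proj₂ q) ∷ (proj₁ p ++ᴸ proj₁ q)) →
      (∀ {h g} → 0# ≤ h → PieceCover h g ps) → (∀ {h g} → 0# ≤ h → PieceCover h g qs) → 0# ≤ h →
      PieceCover h g (cartesianProductWith f ps qs ++ᴸ cartesianProductWith f qs ps)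
    compare-cover {h} {g} {ps} {qs} f f-conds P Q 0≤h K =
      pair-cover P Q 0≤h λ { {c , v} {d , w} {k} p∈ q∈ h≤k bp bq →
        let 0≤k = ≤-trans 0≤h h≤k
            e   = ev (v ⊟ w) ρ
            k≤₁ = x≤x+y (⁺-nonneg e)
            k≤₂ = x≤x+y (⁺-nonneg (- e))
        in Neg-split e 0≤k
          (K (∈-++⁺ˡ (∈-cartesianProductWith⁺ f p∈ q∈)) (≤-trans h≤k k≤₁)
             (subst (Below _ ρ) (sym (f-conds (c , v) (d , w)))
               (Neg-⁺ e 0≤k ∷ ++⁺ (Below-weaken k≤₁ bp) (Below-weaken k≤₁ bq))))
          (K (∈-++⁺ʳ _ (∈-cartesianProductWith⁺ f q∈ p∈)) (≤-trans h≤k k≤₂)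
             (subst (Below _ ρ) (sym (f-conds (d , w) (c , v)))
               (Neg-≡ (opposite v w) (Neg-⁺ (- e) 0≤k) ∷ ++⁺ (Below-weaken k≤₂ bq) (Below-weaken k≤₂ bp)))) }
      where
      opposite : ∀ v w → - ev (v ⊟ w) ρ ≡ ev (w ⊟ v) ρ
      opposite v w = trans (cong -_ (ev-⊟ v w ρ)) (trans
        (solve (ev v ρ ∷ ev w ρ ∷ []) (:- (v₀ :- v₁)) (v₁ :- v₀) refl) (sym (ev-⊟ w v ρ)))

    pieces-cover : ∀ t {h g} → 0# ≤ h → PieceCover h g (pieces t)
    pieces-cover (var i) 0≤h K = K (here refl) ≤-refl []
    pieces-cover (s ⊕ t) 0≤h K = pair-cover (pieces-cover s) (pieces-cover t) 0≤h
      λ p∈ q∈ h≤k bp bq → K (∈-cartesianProductWith⁺ plus p∈ q∈) h≤k (++⁺ bp bq)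
    pieces-cover (⊖ t)   0≤h K = pieces-cover t 0≤h λ p∈ → K (∈-map⁺ minus p∈)
    pieces-cover 𝟘       0≤h K = K (here refl) ≤-refl []
    pieces-cover (s ⊻ t) 0≤h K = compare-cover upper (λ p q → refl) (pieces-cover s) (pieces-cover t) 0≤h K
    pieces-cover (s ⊼ t) 0≤h K = compare-cover lower (λ p q → refl) (pieces-cover s) (pieces-cover t) 0≤h K

    cones-sound : ∀ es {h c} → 0# ≤ h → c ∈ cones es → Below h ρ c → Holds h τ es
    cones-sound [] 0≤h _ _ = []
    cones-sound ((s , t) ∷ es) 0≤h c∈ b
      with ∈-cartesianProductWith⁻ _++ᴸ_ (cartesianProductWith agree (pieces s) (pieces t)) (cones es) c∈
    ... | e , r , e∈ , r∈ , refl with ∈-cartesianProductWith⁻ agree (pieces s) (pieces t) e∈ | ++⁻ˡ e b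
    ... | (c , v) , (d , w) , p∈ , q∈ , refl | v≤w ∷ w≤v ∷ b′ =
      ≈-trans (pieces-sound 0≤h s p∈ (++⁻ˡ c b′))
        (≈-trans (Neg-≡ (ev-⊟ v w ρ) v≤w , Neg-≡ (ev-⊟ w v ρ) w≤v) (≈-sym (pieces-sound 0≤h t q∈ (++⁻ʳ c b′))))
      ∷ cones-sound es 0≤h r∈ (++⁻ʳ e b)

    cones-cover : ∀ es {h g} → 0# ≤ h → Holds h τ es → Covers h ρ g (cones es)
    cones-cover [] 0≤h [] K = K (here refl) ≤-refl []
    cones-cover ((s , t) ∷ es) 0≤h (eq ∷ eqs) K =
      pair-cover (pieces-cover s) (pieces-cover t) 0≤h λ { {c , v} {d , w} p∈ q∈ h≤k bp bq →
        let 0≤k = ≤-trans 0≤h h≤k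
            v≈w = ≈-trans (≈-sym (pieces-sound 0≤k s p∈ bp)) (≈-trans (≈-weaken h≤k eq) (pieces-sound 0≤k t q∈ bq))
        in cones-cover es 0≤k (Holds-weaken h≤k eqs) λ r∈ k≤k′ br →
          K (∈-cartesianProductWith⁺ _++ᴸ_ (∈-cartesianProductWith⁺ agree p∈ q∈) r∈) (≤-trans h≤k k≤k′)
            (++⁺ (Below-weaken k≤k′
                   (Neg-≡ (sym (ev-⊟ v w ρ)) (proj₁ v≈w) ∷ Neg-≡ (sym (ev-⊟ w v ρ)) (proj₂ v≈w) ∷ ++⁺ bp bq)) br) }

-- Linear elimination

-- Consequence is semantic, over all ℓ-groups of level `a` and all `h ≥ 0`: nonnegative combinations
-- and division by positive integers come from the closure properties of `Neg`.
Entails : ∀ {n} a → List (Form n) → Form n → Set (lsuc a)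
Entails a C g = (A : AbelianLGroup a) → let open Semantics A in
  ∀ {h ρ} → 0# ≤ h → Below h ρ C → Neg h (ev g ρ)

-- This is `l` with `zs / β` put for its first `m` variables, multiplied by `β` to clear the
-- denominator.
substitute : ∀ {m n} → ℤ → Form (m ℕ.+ n) → Vec (Form n) m → Form n
substitute β l       []       = β ⊠ l
substitute β (k ∷ l) (z ∷ zs) = k ⊠ z ⊞ substitute β l zs

module _ {a} (A : AbelianLGroup a) where
  open Semantics A

  evs : ∀ {m n} → Vec (Form n) m → Vec Carrier n → Vec Carrier m
  evs zs x = map (λ f → ev f x) zs

  ev-substitute : ∀ {m n} β (l : Form (m ℕ.+ n)) (zs : Vec (Form n) m) (x : Vec Carrier n) →
    ev (substitute β l zs) x ≡ ev l (evs zs x ++ map (β •_) x)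
  ev-substitute β l       []       x = trans (ev-⊠ β l x) (sym (ev-map β l x))
  ev-substitute β (k ∷ l) (z ∷ zs) x =
    trans (ev-⊞ (k ⊠ z) _ x) (cong₂ _+_ (ev-⊠ k z x) (ev-substitute β l zs x))

  ev-substitute-scale : ∀ {m n} i β (l : Form (m ℕ.+ n)) (zs : Vec (Form n) m) (x : Vec Carrier n) →
    ev (substitute (i ℤ.* β) l (map (i ⊠_) zs)) x ≡ i • ev (substitute β l zs) x
  ev-substitute-scale i β l [] x =
    trans (ev-⊠ (i ℤ.* β) l x) (trans (•-assoc i β _) (cong (i •_) (sym (ev-⊠ β l x))))
  ev-substitute-scale i β (k ∷ l) (z ∷ zs) x = begin
    ev (k ⊠ (i ⊠ z) ⊞ substitute (i ℤ.* β) l (map (i ⊠_) zs)) x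
      ≡⟨ trans (ev-⊞ (k ⊠ (i ⊠ z)) _ x) (cong₂ _+_ (trans (ev-⊠ k (i ⊠ z) x) (cong (k •_) (ev-⊠ i z x)))
               (ev-substitute-scale i β l zs x)) ⟩
    k • (i • ev z x) + i • ev (substitute β l zs) x
      ≡⟨ cong (_+ (i • ev (substitute β l zs) x)) (•-comm k i _) ⟩
    i • (k • ev z x) + i • ev (substitute β l zs) x
      ≡⟨ sym (•-distribˡ i _ _) ⟩
    i • (k • ev z x + ev (substitute β l zs) x)
      ≡⟨ cong (i •_) (sym (trans (ev-⊞ (k ⊠ z) _ x) (cong (_+ ev (substitute β l zs) x) (ev-⊠ k z x)))) ⟩
    i • ev (k ⊠ z ⊞ substitute β l zs) x ∎
    where open ≡-Reasoning

  •-minusʳ : ∀ i x → i • (- x) ≡ - (i • x)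
  •-minusʳ i x = trans (cong (i •_) (sym (•-minus x))) (trans (•-comm i -1ℤ x) (•-minus _))

  •-distrib-- : ∀ i x y → i • (x - y) ≡ i • x - i • y
  •-distrib-- i x y = trans (•-distribˡ i x (- y)) (cong (λ u → i • x + u) (•-minusʳ i y))

  ev-⊟⊠ : ∀ {n} i j (l m : Form n) x → ev (i ⊠ l ⊟ j ⊠ m) x ≡ i • ev l x - j • ev m x
  ev-⊟⊠ i j l m x = trans (ev-⊟ (i ⊠ l) (j ⊠ m) x) (cong₂ _-_ (ev-⊠ i l x) (ev-⊠ j m x))

  ev-⊞⊠ : ∀ {n} i j (l m : Form n) x → ev (i ⊠ l ⊞ j ⊠ m) x ≡ i • ev l x + j • ev m x
  ev-⊞⊠ i j l m x = trans (ev-⊞ (i ⊠ l) (j ⊠ m) x) (cong₂ _+_ (ev-⊠ i l x) (ev-⊠ j m x))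

-- Fourier–Motzkin elimination over the linear forms in n parameters.  The forms are compared
-- through an oracle in continuation-passing style, so that it may refine the current world.
module Elimination {a n w r}
  (World : Set w) (_≼_ : World → World → Set)
  (≼-refl : ∀ {C} → C ≼ C) (≼-trans : ∀ {C D E} → C ≼ D → D ≼ E → C ≼ E)
  (forms : World → List (Form n))
  (Positive : World → Form n → Set)
  (Positive⇒Entails : ∀ {C g} → Positive C g → Entails a (forms C) (-1ℤ ⊠ g))
  (Entails-mono : ∀ {C D} → C ≼ D → ∀ g → Entails a (forms C) g → Entails a (forms D) g)
  (R : World → Set r)
  (compare : ∀ C g → (∀ D → C ≼ D → Entails a (forms D) g ⊎ Positive D g → R D) → R C)
  where

  infix 4 _⊢_
  _⊢_ : World → Form n → Set (lsuc a)
  C ⊢ g = Entails a (forms C) g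

  Feasible : ∀ m → List (Form (m ℕ.+ n)) → World → Set (lsuc a)
  Feasible m P C = Σ ℕ λ b → Σ (Vec (Form n) m) λ zs → ∀ {l} → l ∈ P → C ⊢ substitute (+ suc b) l zs

  -- The certificate `g` involves the parameters alone: `P` forces it to be nonpositive whereas the
  -- world makes it positive.
  Infeasible : ∀ m → List (Form (m ℕ.+ n)) → World → Set (lsuc a)
  Infeasible m P C = Σ (Form n) λ g → Positive C g ×
    ((A : AbelianLGroup a) → let open Semantics A in
      ∀ {h} {z : Vec Carrier m} {x} → 0# ≤ h → Below h (z ++ x) P → Neg h (ev g x))

  infixr 2 _⟶_
  _⟶_ : ∀ {p} → World → (World → Set p) → Set _
  C ⟶ X = (∀ D → C ≼ D → X D → R D) → R C

  -- (p , r) stands for the fraction r / (p + 1).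
  Fraction : Set
  Fraction = ℕ × Form n

  _≤ᶠ_ : Fraction → Fraction → Form n
  (p , r) ≤ᶠ (q , s) = (+ suc q) ⊠ r ⊟ (+ suc p) ⊠ s

  ≤ᶠ-refl : ∀ {C} x → C ⊢ x ≤ᶠ x
  ≤ᶠ-refl (p , r) A {h} {ρ} 0≤h b = Neg-≡ (sym (ev-⊟⊠ A (+ suc p) (+ suc p) r r ρ)) (proj₁ ≈-refl)
    where open Semantics A

  ≤ᶠ-trans : ∀ {C} x y z → C ⊢ x ≤ᶠ y → C ⊢ y ≤ᶠ z → C ⊢ x ≤ᶠ z
  ≤ᶠ-trans (p , r) (q , s) (o , t) xy yz A {h} {ρ} 0≤h b =
    Neg-≡ (sym (ev-⊟⊠ A O P r t ρ))
      -- `o + 1` times the first inequality plus `p + 1` times the second is `q + 1` times the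
      -- wanted one.
      (Neg-cancel q 0≤h (Neg-≡ eq (Neg-+
        (Neg-• (suc o) (Neg-≡ (ev-⊟⊠ A Q P r s ρ) (xy A 0≤h b)))
        (Neg-• (suc p) (Neg-≡ (ev-⊟⊠ A O Q s t ρ) (yz A 0≤h b))))))
    where
    open Semantics A
    P = + suc p
    Q = + suc q
    O = + suc o
    X = ev r ρ
    Y = ev s ρ
    Z = ev t ρ
    eq : O • (Q • X - P • Y) + P • (O • Y - Q • Z) ≡ Q • (O • X - P • Z)
    eq = begin
      O • (Q • X - P • Y) + P • (O • Y - Q • Z)
        ≡⟨ cong₂ _+_ (•-distrib-- A O _ _) (•-distrib-- A P _ _) ⟩
      (O • Q • X - O • P • Y) + (P • O • Y - P • Q • Z)
        ≡⟨ cong₂ (λ u v → (O • Q • X - u) + (P • O • Y - v)) (•-comm O P Y) (•-comm P Q Z) ⟩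
      (O • Q • X - P • O • Y) + (P • O • Y - Q • P • Z)
        ≡⟨ solve (O • Q • X ∷ P • O • Y ∷ Q • P • Z ∷ []) ((v₀ :- v₁) :+ (v₁ :- v₂)) (v₀ :- v₂) refl ⟩
      O • Q • X - Q • P • Z
        ≡⟨ cong (_- (Q • P • Z)) (•-comm O Q X) ⟩
      Q • O • X - Q • P • Z
        ≡⟨ sym (•-distrib-- A Q _ _) ⟩
      Q • (O • X - P • Z) ∎
      where open ≡-Reasoning

  ≤ᶠ-flip : ∀ {C} x y → C ⊢ -1ℤ ⊠ (x ≤ᶠ y) → C ⊢ y ≤ᶠ x
  ≤ᶠ-flip (p , r) (q , s) e A {h} {ρ} 0≤h b = Neg-≡ eq (e A 0≤h b)
    where
    open Semantics A
    eq : ev (-1ℤ ⊠ ((p , r) ≤ᶠ (q , s))) ρ ≡ ev ((q , s) ≤ᶠ (p , r)) ρ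
    eq = trans (ev-neg ((p , r) ≤ᶠ (q , s)) ρ) (trans (cong -_ (ev-⊟⊠ A (+ suc q) (+ suc p) r s ρ))
      (trans (solve ((+ suc q) • ev r ρ ∷ (+ suc p) • ev s ρ ∷ []) (:- (v₀ :- v₁)) (v₁ :- v₀) refl)
        (sym (ev-⊟⊠ A (+ suc p) (+ suc q) s r ρ))))

  maximum : ∀ C x xs → C ⟶ λ D → Σ Fraction λ y → (y ∈ x ∷ xs) × (∀ {z} → z ∈ x ∷ xs → D ⊢ z ≤ᶠ y)
  maximum C x [] K = K C ≼-refl (x , here refl , λ { (here refl) → ≤ᶠ-refl x })
  maximum C x (x′ ∷ xs) K = maximum C x′ xs λ { D C≼D (y , y∈ , y-max) →
    compare D (x ≤ᶠ y) λ
      { E D≼E (inj₁ x≤y) → K E (≼-trans C≼D D≼E)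
          (y , there y∈ , λ { (here refl) → x≤y ; {z} (there z∈) → Entails-mono D≼E (z ≤ᶠ y) (y-max z∈) })
      ; E D≼E (inj₂ pos) → K E (≼-trans C≼D D≼E)
          (x , here refl , λ { (here refl) → ≤ᶠ-refl x
                             ; {z} (there z∈) → ≤ᶠ-trans z y x (Entails-mono D≼E (z ≤ᶠ y) (y-max z∈))
                                              (≤ᶠ-flip x y (Positive⇒Entails pos)) }) } }

  resolvent : ∀ {m} → ℕ × Form m → ℕ × Form m → Form m
  resolvent (p , l) (q , k) = (+ suc q) ⊠ l ⊞ (+ suc p) ⊠ k

  -- x lies above the lower bounds r / (p + 1) and below the upper bounds - s / (q + 1).
  Between : List Fraction → List Fraction → World → Set (lsuc a)
  Between lo up C = Σ Fraction λ x →
    (∀ {y} → y ∈ lo → C ⊢ y ≤ᶠ x) × (∀ {y} → y ∈ up → C ⊢ resolvent x y)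

  -- The largest lower bound is chosen, and `compat` puts it below every upper bound. Failing lower
  -- bounds the smallest upper bound serves, and 0 when there are no bounds at all.
  between : ∀ C lo up → (∀ {x y} → x ∈ lo → y ∈ up → C ⊢ resolvent x y) → C ⟶ Between lo up
  between C [] [] compat K = K C ≼-refl ((0 , 𝟎) , (λ ()) , λ ())
  between C [] (y ∷ ys) compat K = maximum C y ys λ { D C≼D ((q , s) , _ , max) →
    -- Upper bounds are stored with opposite sign, so the smallest one is minus the maximum
    -- `s / (q + 1)`.
    K D C≼D ((q , -1ℤ ⊠ s) , (λ ()) , λ { {p , r} z∈ A {h} {ρ} 0≤h b → let open Semantics A in
      Neg-≡ (trans (ev-⊟⊠ A (+ suc q) (+ suc p) r s ρ) (sym (trans (ev-⊞⊠ A (+ suc p) (+ suc q) (-1ℤ ⊠ s) r ρ)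
        (trans (cong (λ u → (+ suc p) • u + (+ suc q) • ev r ρ) (ev-neg s ρ))
          (trans (cong (_+ ((+ suc q) • ev r ρ)) (•-minusʳ A (+ suc p) (ev s ρ)))
            (solve ((+ suc q) • ev r ρ ∷ (+ suc p) • ev s ρ ∷ []) (:- v₁ :+ v₀) (v₀ :- v₁) refl))))))
        (max z∈ A 0≤h b) }) }
  between C (x ∷ xs) up compat K = maximum C x xs λ { D C≼D (y , y∈ , max) →
    K D C≼D (y , max , λ {z} z∈ → Entails-mono C≼D (resolvent y z) (compat y∈ z∈)) }

  zeros : ∀ {m} → List (Form (suc m)) → List (Form m)
  zeros []                   = []
  zeros ((+ zero ∷ l) ∷ P)   = l ∷ zeros P
  zeros ((+ suc _ ∷ l) ∷ P)  = zeros P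
  zeros ((-[1+ _ ] ∷ l) ∷ P) = zeros P

  -- A row `-(p + 1) z + l ≤ 0` says `z ≥ l / (p + 1)`, while a row `(q + 1) z + l ≤ 0`, collected
  -- in `uppers`, says `z ≤ - l / (q + 1)`.
  lowers : ∀ {m} → List (Form (suc m)) → List (ℕ × Form m)
  lowers []                   = []
  lowers ((+ _ ∷ l) ∷ P)      = lowers P
  lowers ((-[1+ p ] ∷ l) ∷ P) = (p , l) ∷ lowers P

  uppers : ∀ {m} → List (Form (suc m)) → List (ℕ × Form m)
  uppers []                   = []
  uppers ((+ zero ∷ l) ∷ P)   = uppers P
  uppers ((+ suc q ∷ l) ∷ P)  = (q , l) ∷ uppers P
  uppers ((-[1+ _ ] ∷ l) ∷ P) = uppers P

  ∈-zeros⁻ : ∀ {m l} (P : List (Form (suc m))) → l ∈ zeros P → (0ℤ ∷ l) ∈ P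
  ∈-zeros⁻ ((+ zero ∷ l) ∷ P)   (here refl) = here refl
  ∈-zeros⁻ ((+ zero ∷ l) ∷ P)   (there l∈)  = there (∈-zeros⁻ P l∈)
  ∈-zeros⁻ ((+ suc _ ∷ l) ∷ P)  l∈          = there (∈-zeros⁻ P l∈)
  ∈-zeros⁻ ((-[1+ _ ] ∷ l) ∷ P) l∈          = there (∈-zeros⁻ P l∈)

  ∈-lowers⁻ : ∀ {m p l} (P : List (Form (suc m))) → (p , l) ∈ lowers P → (-[1+ p ] ∷ l) ∈ P
  ∈-lowers⁻ ((+ _ ∷ l) ∷ P)      l∈          = there (∈-lowers⁻ P l∈)
  ∈-lowers⁻ ((-[1+ _ ] ∷ l) ∷ P) (here refl) = here refl
  ∈-lowers⁻ ((-[1+ _ ] ∷ l) ∷ P) (there l∈)  = there (∈-lowers⁻ P l∈)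

  ∈-uppers⁻ : ∀ {m p l} (P : List (Form (suc m))) → (p , l) ∈ uppers P → (+ suc p ∷ l) ∈ P
  ∈-uppers⁻ ((+ zero ∷ l) ∷ P)   l∈          = there (∈-uppers⁻ P l∈)
  ∈-uppers⁻ ((+ suc _ ∷ l) ∷ P)  (here refl) = here refl
  ∈-uppers⁻ ((+ suc _ ∷ l) ∷ P)  (there l∈)  = there (∈-uppers⁻ P l∈)
  ∈-uppers⁻ ((-[1+ _ ] ∷ l) ∷ P) l∈          = there (∈-uppers⁻ P l∈)

  ∈-zeros⁺ : ∀ {m l} {P : List (Form (suc m))} → (0ℤ ∷ l) ∈ P → l ∈ zeros P
  ∈-zeros⁺                            (here refl) = here refl
  ∈-zeros⁺ {P = (+ zero ∷ _) ∷ _}   (there l∈) = there (∈-zeros⁺ l∈)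
  ∈-zeros⁺ {P = (+ suc _ ∷ _) ∷ _}  (there l∈) = ∈-zeros⁺ l∈
  ∈-zeros⁺ {P = (-[1+ _ ] ∷ _) ∷ _} (there l∈) = ∈-zeros⁺ l∈

  ∈-lowers⁺ : ∀ {m p l} {P : List (Form (suc m))} → (-[1+ p ] ∷ l) ∈ P → (p , l) ∈ lowers P
  ∈-lowers⁺                            (here refl) = here refl
  ∈-lowers⁺ {P = (+ _ ∷ _) ∷ _}      (there l∈) = ∈-lowers⁺ l∈
  ∈-lowers⁺ {P = (-[1+ _ ] ∷ _) ∷ _} (there l∈) = there (∈-lowers⁺ l∈)

  ∈-uppers⁺ : ∀ {m p l} {P : List (Form (suc m))} → (+ suc p ∷ l) ∈ P → (p , l) ∈ uppers P
  ∈-uppers⁺                            (here refl) = here refl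
  ∈-uppers⁺ {P = (+ zero ∷ _) ∷ _}   (there l∈) = ∈-uppers⁺ l∈
  ∈-uppers⁺ {P = (+ suc _ ∷ _) ∷ _}  (there l∈) = there (∈-uppers⁺ l∈)
  ∈-uppers⁺ {P = (-[1+ _ ] ∷ _) ∷ _} (there l∈) = ∈-uppers⁺ l∈

  eliminate : ∀ {m} → List (Form (suc m)) → List (Form m)
  eliminate P = zeros P ++ᴸ cartesianProductWith resolvent (lowers P) (uppers P)

  eliminate-sound : (A : AbelianLGroup a) → let open Semantics A in
    ∀ {m h z} {x : Vec Carrier m} P → Below h (z ∷ x) P → Below h x (eliminate P)
  eliminate-sound A {h = h} {z} {x} P b = All.tabulate λ l∈ → [ zero-row , resolvent-row ]′ (∈-++⁻ (zeros P) l∈)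
    where
    open Semantics A
    zero-row : ∀ {l} → l ∈ zeros P → Neg h (ev l x)
    zero-row {l} l∈ = Neg-≡ (solve (ev l x ∷ []) (:0 :+ v₀) v₀ refl) (All.lookup b (∈-zeros⁻ P l∈))
    resolvent-row : ∀ {l} → l ∈ cartesianProductWith resolvent (lowers P) (uppers P) → Neg h (ev l x)
    resolvent-row l∈ with ∈-cartesianProductWith⁻ resolvent (lowers P) (uppers P) l∈
    ... | (p , l) , (q , k) , l∈′ , k∈ , refl = Neg-≡ eq
      (Neg-+ (Neg-• (suc q) (All.lookup b (∈-lowers⁻ P l∈′))) (Neg-• (suc p) (All.lookup b (∈-uppers⁻ P k∈))))
      where
      p′ = + suc p
      q′ = + suc q
      L  = ev l x
      K  = ev k x
      eq : q′ • (- (p′ • z) + L) + p′ • (q′ • z + K) ≡ ev (resolvent (p , l) (q , k)) x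
      eq = begin
        q′ • (- (p′ • z) + L) + p′ • (q′ • z + K)
          ≡⟨ cong₂ _+_ (•-distribˡ q′ _ L) (•-distribˡ p′ _ K) ⟩
        (q′ • (- (p′ • z)) + q′ • L) + (p′ • q′ • z + p′ • K)
          ≡⟨ cong₂ (λ u v → (u + q′ • L) + (v + p′ • K)) (•-minusʳ A q′ _) (•-comm p′ q′ z) ⟩
        (- (q′ • p′ • z) + q′ • L) + (q′ • p′ • z + p′ • K)
          ≡⟨ solve (q′ • p′ • z ∷ q′ • L ∷ p′ • K ∷ []) ((:- v₀ :+ v₁) :+ (v₀ :+ v₂)) (v₁ :+ v₂) refl ⟩
        q′ • L + p′ • K
          ≡⟨ sym (ev-⊞⊠ A q′ p′ l k x) ⟩
        ev (resolvent (p , l) (q , k)) x ∎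
        where open ≡-Reasoning

  Outcome : ∀ m → List (Form (m ℕ.+ n)) → World → Set (lsuc a)
  Outcome m P C = Feasible m P C ⊎ Infeasible m P C

  solve₀ : ∀ C P → C ⟶ Outcome 0 P
  solve₀ C [] K = K C ≼-refl (inj₁ (0 , [] , λ ()))
  solve₀ C (l ∷ P) K = solve₀ C P λ
    { D C≼D (inj₂ (g , pos , inf)) → K D C≼D (inj₂ (g , pos , λ { A {z = []} 0≤h (_ ∷ b) → inf A {z = []} 0≤h b }))
    ; D C≼D (inj₁ (b , [] , feas)) → compare D l λ
      { E D≼E (inj₁ l≤0) → K E (≼-trans C≼D D≼E) (inj₁ (b , [] , λ
          { (here refl) A 0≤h below → let open Semantics A in
              Neg-≡ (sym (ev-⊠ (+ suc b) l _)) (Neg-• (suc b) (l≤0 A 0≤h below))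
          ; {k} (there k∈) → Entails-mono D≼E ((+ suc b) ⊠ k) (feas k∈) }))
      -- The row has no unknowns left and is itself the certificate.
      ; E D≼E (inj₂ pos) → K E (≼-trans C≼D D≼E) (inj₂ (l , pos , λ { A {z = []} 0≤h (b ∷ _) → b })) } }

  eliminate-complete : ∀ {m D} P → Feasible m (eliminate P) D → D ⟶ Feasible (suc m) P
  eliminate-complete {m} {D} P (b , zs , feas) K =
    between D (mapᴸ residual (lowers P)) (mapᴸ residual (uppers P)) compat back
    where
    residual : ℕ × Form (m ℕ.+ n) → Fraction
    residual (p , l) = p , substitute (+ suc b) l zs

    compat : ∀ {x y} → x ∈ mapᴸ residual (lowers P) → y ∈ mapᴸ residual (uppers P) → D ⊢ resolvent x y
    compat x∈ y∈ with ∈-map⁻ residual x∈ | ∈-map⁻ residual y∈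
    ... | (p , l) , l∈ , refl | (q , k) , k∈ , refl = λ A {h} {x} 0≤h below → let open Semantics A in
      Neg-≡ (trans (ev-substitute A (+ suc b) (resolvent (p , l) (q , k)) zs x)
               (trans (ev-⊞⊠ A (+ suc q) (+ suc p) l k _)
                 (sym (trans (ev-⊞⊠ A (+ suc q) (+ suc p) (substitute (+ suc b) l zs) (substitute (+ suc b) k zs) x)
                   (cong₂ (λ u v → (+ suc q) • u + (+ suc p) • v)
                     (ev-substitute A (+ suc b) l zs x) (ev-substitute A (+ suc b) k zs x))))))
        (feas (∈-++⁺ʳ (zeros P) (∈-cartesianProductWith⁺ resolvent l∈ k∈)) A 0≤h below)

    back : ∀ E → D ≼ E → Between (mapᴸ residual (lowers P)) (mapᴸ residual (uppers P)) E → R E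
    -- The residuals carry a factor `b + 1`, so the new unknown is `w / ((p + 1)(b + 1))`. The
    -- number supplied is this denominator less one, and the old numerators are multiplied by
    -- `p + 1` to match it.
    back E D≼E ((p , w) , above , below) = K E D≼E (b ℕ.+ p ℕ.* suc b , w ∷ map ((+ suc p) ⊠_) zs , row)
      where
      value : (A : AbelianLGroup a) → let open Semantics A in ∀ k (l : Form (m ℕ.+ n)) (x : Vec Carrier n) →
        ev (substitute (+ suc (b ℕ.+ p ℕ.* suc b)) (k ∷ l) (w ∷ map ((+ suc p) ⊠_) zs)) x ≡
        k • ev w x + (+ suc p) • ev (substitute (+ suc b) l zs) x
      value A k l x = trans (ev-⊞ (k ⊠ w) _ x) (cong₂ _+_ (ev-⊠ k w x) (ev-substitute-scale A (+ suc p) (+ suc b) l zs x))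
        where open Semantics A

      row : ∀ {l} → l ∈ P → E ⊢ substitute (+ suc (b ℕ.+ p ℕ.* suc b)) l (w ∷ map ((+ suc p) ⊠_) zs)
      row {+ zero ∷ l} l∈ A {h} {x} 0≤h c = Neg-≡
        (trans (solve ((+ suc p) • ev (substitute (+ suc b) l zs) x ∷ []) v₀ (:0 :+ v₀) refl) (sym (value A 0ℤ l x)))
        (Neg-• (suc p) (Entails-mono D≼E (substitute (+ suc b) l zs) (feas (∈-++⁺ˡ (∈-zeros⁺ l∈))) A 0≤h c))
        where open Semantics A
      row {+ suc q ∷ l} l∈ A {h} {x} 0≤h c = Neg-≡
        (trans (ev-⊞⊠ A (+ suc q) (+ suc p) w (substitute (+ suc b) l zs) x) (sym (value A (+ suc q) l x)))
        (below (∈-map⁺ residual (∈-uppers⁺ l∈)) A 0≤h c)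
        where open Semantics A
      row { -[1+ q ] ∷ l} l∈ A {h} {x} 0≤h c = Neg-≡
        (trans (ev-⊟⊠ A (+ suc p) (+ suc q) (substitute (+ suc b) l zs) w x)
          (trans (solve ((+ suc p) • ev (substitute (+ suc b) l zs) x ∷ (+ suc q) • ev w x ∷ []) (v₀ :- v₁) (:- v₁ :+ v₀) refl)
            (sym (value A -[1+ q ] l x))))
        (above (∈-map⁺ residual (∈-lowers⁺ l∈)) A 0≤h c)
        where open Semantics A

  decide : ∀ m C P → C ⟶ Outcome m P
  decide zero    C P K = solve₀ C P K
  decide (suc m) C P K = decide m C (eliminate P) λ
    { D C≼D (inj₁ feas) → eliminate-complete P feas λ E D≼E f → K E (≼-trans C≼D D≼E) (inj₁ f)
    ; D C≼D (inj₂ (g , pos , inf)) → K D C≼D (inj₂ (g , pos , λ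
        { A {z = _ ∷ _} 0≤h b → inf A 0≤h (eliminate-sound A P b) })) }

-- Integer points of linear systems and full-dimensional cells.

dot-⊠ : ∀ {n} k (l : Form n) v → dot (k ⊠ l) v ≡ k ℤ.* dot l v
dot-⊠ k []      []      = sym (ℤ.*-zeroʳ k)
dot-⊠ k (j ∷ l) (i ∷ v) = trans (cong (λ s → k ℤ.* j ℤ.* i ℤ.+ s) (dot-⊠ k l v)) (rearrange k j i (dot l v))
  where
  rearrange : ∀ k j i d → k ℤ.* j ℤ.* i ℤ.+ k ℤ.* d ≡ k ℤ.* (j ℤ.* i ℤ.+ d)
  rearrange = solve-∀

dot-affine : ∀ {n} k (l : Form n) v u → dot l (k ⊠ v ⊞ u) ≡ k ℤ.* dot l v ℤ.+ dot l u
dot-affine k []      []      []      = sym (cong (ℤ._+ 0ℤ) (ℤ.*-zeroʳ k))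
dot-affine k (j ∷ l) (i ∷ v) (e ∷ u) =
  trans (cong (λ s → j ℤ.* (k ℤ.* i ℤ.+ e) ℤ.+ s) (dot-affine k l v u)) (rearrange k j i e (dot l v) (dot l u))
  where
  rearrange : ∀ k j i e d d′ →
    j ℤ.* (k ℤ.* i ℤ.+ e) ℤ.+ (k ℤ.* d ℤ.+ d′) ≡ k ℤ.* (j ℤ.* i ℤ.+ d) ℤ.+ (j ℤ.* e ℤ.+ d′)
  rearrange = solve-∀

dot-𝟎 : ∀ {n} (l : Form n) → dot l 𝟎 ≡ 0ℤ
dot-𝟎 []      = refl
dot-𝟎 (k ∷ l) = trans (cong₂ ℤ._+_ (ℤ.*-zeroʳ k) (dot-𝟎 l)) refl

dot-unit : ∀ {n} (l : Form n) i → dot l (unit i) ≡ lookup l i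
dot-unit (k ∷ l) zero    = trans (cong₂ ℤ._+_ (ℤ.*-identityʳ k) (dot-𝟎 l)) (ℤ.+-identityʳ k)
dot-unit (k ∷ l) (suc i) = trans (cong₂ ℤ._+_ (ℤ.*-zeroʳ k) (dot-unit l i)) (ℤ.+-identityˡ _)

-- A negative integer is at most -1, so `M d ≤ - M` absorbs `e`. Geometrically, a large multiple of
-- an interior point of a cell may be perturbed by a fixed vector.
dominated : ∀ {d M} e → d ℤ.< 0ℤ → ℤ.∣ e ∣ ℕ.≤ M → (+ M) ℤ.* d ℤ.+ e ℤ.≤ 0ℤ
dominated {d} {M} e d<0 ∣e∣≤M = begin
  (+ M) ℤ.* d ℤ.+ e      ≤⟨ ℤ.+-mono-≤ (ℤ.*-monoˡ-≤-nonNeg (+ M) (d≤-1 d<0)) (e≤M e ∣e∣≤M) ⟩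
  (+ M) ℤ.* -1ℤ ℤ.+ + M  ≡⟨ cancel (+ M) ⟩
  0ℤ                     ∎
  where
  open ℤ.≤-Reasoning
  d≤-1 : ∀ {d} → d ℤ.< 0ℤ → d ℤ.≤ -1ℤ
  d≤-1 ℤ.-<+ = ℤ.-≤- z≤n
  e≤M : ∀ e → ℤ.∣ e ∣ ℕ.≤ M → e ℤ.≤ + M
  e≤M (+ _)    p = ℤ.+≤+ p
  e≤M -[1+ _ ] p = ℤ.-≤+
  cancel : ∀ i → i ℤ.* -1ℤ ℤ.+ i ≡ 0ℤ
  cancel = solve-∀

dominated-< : ∀ {d} e → d ℤ.< 0ℤ → (+ suc ℤ.∣ e ∣) ℤ.* d ℤ.+ e ℤ.< 0ℤ
dominated-< {d} e d<0 = begin-strict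
  (+ suc ℤ.∣ e ∣) ℤ.* d ℤ.+ e         ≡⟨ cong (ℤ._+ e) (ℤ.suc-* (+ ℤ.∣ e ∣) d) ⟩
  (d ℤ.+ (+ ℤ.∣ e ∣) ℤ.* d) ℤ.+ e     ≡⟨ ℤ.+-assoc d _ e ⟩
  d ℤ.+ ((+ ℤ.∣ e ∣) ℤ.* d ℤ.+ e)     <⟨ ℤ.+-mono-<-≤ d<0 (dominated e d<0 ℕ.≤-refl) ⟩
  0ℤ ∎
  where open ℤ.≤-Reasoning

-- The strict interior point makes the cell full-dimensional. This leaves room to vary one
-- coordinate at a time, which later isolates single coefficients.
record Cell (n : ℕ) : Set where
  field
    forms    : List (Form n)
    point    : Vec ℤ n
    interior : All (λ l → dot l point ℤ.< 0ℤ) forms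

open Cell

_≼_ : ∀ {n} → Cell n → Cell n → Set
C ≼ D = ∀ {l} → l ∈ forms C → l ∈ forms D

extend : ∀ {n} (C : Cell n) k {u} → All (λ l → dot l u ℤ.≤ 0ℤ) (forms C) → dot k u ℤ.< 0ℤ → Cell n
extend C k {u} below k<0 = record
  { forms    = k ∷ forms C
  -- `u` satisfies the old forms weakly and `k` strictly; adding a large multiple of it to the old
  -- interior point keeps the old forms strict and makes `k` strict.
  ; point    = (+ M) ⊠ u ⊞ point C
  ; interior = subst (ℤ._< 0ℤ) (sym (dot-affine (+ M) k u (point C))) (dominated-< (dot k (point C)) k<0)
             ∷ All.tabulate λ {l} l∈ → subst (ℤ._< 0ℤ) (sym (dot-affine (+ M) l u (point C)))
                 (ℤ.+-mono-≤-< (subst ((+ M) ℤ.* dot l u ℤ.≤_) (ℤ.*-zeroʳ (+ M))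
                   (ℤ.*-monoˡ-≤-nonNeg (+ M) (All.lookup below l∈))) (All.lookup (interior C) l∈))
  }
  where M = suc ℤ.∣ dot k (point C) ∣

Entails-mono : ∀ {a n} {F G : List (Form n)} → (∀ {l} → l ∈ F → l ∈ G) → ∀ g → Entails a F g → Entails a G g
Entails-mono F⊆G g e A 0≤h b = e A 0≤h (All.tabulate λ l∈ → All.lookup b (F⊆G l∈))

Entails-∈ : ∀ {a n} {F : List (Form n)} {g} → g ∈ F → Entails a F g
Entails-∈ g∈ A 0≤h b = All.lookup b g∈

neg-positive : ∀ {n} (g : Form n) v → 0ℤ ℤ.< dot g v → dot (-1ℤ ⊠ g) v ℤ.< 0ℤ
neg-positive g v p =
  subst (ℤ._< 0ℤ) (sym (trans (dot-⊠ -1ℤ g v) (ℤ.-1*i≡-i (dot g v)))) (ℤ.neg-mono-< p)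

positive-neg : ∀ {n} (g : Form n) v → dot (-1ℤ ⊠ g) v ℤ.< 0ℤ → 0ℤ ℤ.< dot g v
positive-neg g v p = subst (0ℤ ℤ.<_)
  (trans (cong ℤ.-_ (trans (dot-⊠ -1ℤ g v) (ℤ.-1*i≡-i (dot g v)))) (ℤ.neg-involutive (dot g v))) (ℤ.neg-mono-< p)

negative-pos : ∀ {n} (g : Form n) v → 0ℤ ℤ.< dot (-1ℤ ⊠ g) v → dot g v ℤ.< 0ℤ
negative-pos g v p = subst (ℤ._< 0ℤ)
  (trans (cong ℤ.-_ (trans (dot-⊠ -1ℤ g v) (ℤ.-1*i≡-i (dot g v)))) (ℤ.neg-involutive (dot g v))) (ℤ.neg-mono-< p)

-- Farkas' lemma.

module Nonneg {a} (A : AbelianLGroup a) where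
  open Semantics A

  •-nonpos : ∀ {k c} → 0# ≤ c → k ℤ.≤ 0ℤ → k • c ≤ 0#
  •-nonpos {+ zero}            0≤c _ = ≤-refl
  •-nonpos {+ suc _}           0≤c (ℤ.+≤+ ())
  •-nonpos { -[1+ n ]} {c}     0≤c _ = ≤-move (•-nonneg (suc n) 0≤c)
    (solve ((+ suc n) • c ∷ []) (:0 :- v₀) (:- v₀ :- :0) refl)

-- With a single parameter `t ≥ 0` the sign of a form is that of its coefficient. Every comparison
-- is settled outright, so the trivial type `⊤` can serve as the worlds.
parameter≥0 : ⊤ → List (Form 1)
parameter≥0 _ = (-1ℤ ∷ []) ∷ []

Positive₁ : ⊤ → Form 1 → Set
Positive₁ _ (k ∷ []) = 0ℤ ℤ.< k

multiple≤0 : ∀ {a} p → Entails a (parameter≥0 tt) (-[1+ p ] ∷ [])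
multiple≤0 p A {h} {t ∷ []} 0≤h (t≥0 ∷ []) = Neg-≡ eq (Neg-• (suc p) t≥0)
  where
  open Semantics A
  eq : (+ suc p) • (-1ℤ • t + 0#) ≡ - ((+ suc p) • t) + 0#
  eq = trans (cong ((+ suc p) •_) (solve (t ∷ []) (-1ℤ :* v₀ :+ :0) (:- v₀) refl))
    (trans (•-minusʳ A (+ suc p) t) (solve ((+ suc p) • t ∷ []) (:- v₀) (:- v₀ :+ :0) refl))

positive⇒entails : ∀ {a C k} → Positive₁ C k → Entails a (parameter≥0 C) (-1ℤ ⊠ k)
positive⇒entails {k = + zero ∷ []} (ℤ.+<+ ())
positive⇒entails {k = + suc p ∷ []} _ =
  subst (λ j → Entails _ (parameter≥0 tt) (j ∷ [])) (sym (ℤ.-1*i≡-i (+ suc p))) (multiple≤0 p)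
positive⇒entails {k = -[1+ p ] ∷ []} ()

0≤0 : ∀ {a} → Entails a (parameter≥0 tt) (0ℤ ∷ [])
0≤0 A {ρ = t ∷ []} 0≤h _ = ≤0⇒Neg (≤-reflexive (solve (t ∷ []) (0ℤ :* v₀ :+ :0) :0 refl))
  where open Semantics A

-- A nontrivial ℓ-group B contains a copy ℤ c of the integers, on which integer points of linear
-- systems become points of B.
module Integers {a} (B : AbelianLGroup a) (b : AbelianLGroup.Carrier B) (b≢0 : ¬ (b ≡ AbelianLGroup.0# B)) where
  open Semantics B
  open Nonneg B

  -- The absolute value of `b`. It is nonnegative and, as `b` is not 0, not below 0; hence its
  -- integer multiples reflect the sign of the integer.
  c : Carrier
  c = b ⁺ + (- b) ⁺

  0≤c : 0# ≤ c
  0≤c = +-nonneg (⁺-nonneg b) (⁺-nonneg (- b))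

  c≰0 : ¬ (c ≤ 0#)
  c≰0 c≤0 = b≢0 (≤-antisym (≤-trans (x≤x⁺ b) (≤-trans (x≤x+y (⁺-nonneg (- b))) c≤0))
    (≤-move (≤-trans (x≤x⁺ (- b)) (≤-trans (x≤y+x (⁺-nonneg b)) c≤0))
      (solve (b ∷ []) (:- v₀ :- :0) (:0 :- v₀) refl)))

  •c-reflects-≤0 : ∀ k → k • c ≤ 0# → k ℤ.≤ 0ℤ
  •c-reflects-≤0 (+ zero)  _ = ℤ.≤-refl
  •c-reflects-≤0 (+ suc n) p = ⊥-elim (c≰0 (•-cancel-≤0 n p))
  •c-reflects-≤0 -[1+ n ]  _ = ℤ.-≤+

  Alternative : ∀ {m} → List (Form m) → Form m → Set (lsuc a)
  Alternative {m} F g =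
    (Σ (Vec ℤ m) λ v → All (λ l → dot l v ℤ.≤ 0ℤ) F × 0ℤ ℤ.< dot g v) ⊎ Entails a F g

  -- Farkas' lemma is elimination with a single parameter t ≥ 0, applied to F ≤ 0 and t ≤ g.
  module _ {m} (F : List (Form m)) (g : Form m) where

    compare₁ : ∀ (C : ⊤) k → (∀ D → ⊤ → Entails a (parameter≥0 D) k ⊎ Positive₁ D k → Alternative F g) → Alternative F g
    compare₁ C (+ zero ∷ [])   K = K tt tt (inj₁ 0≤0)
    compare₁ C (+ suc p ∷ [])  K = K tt tt (inj₂ (ℤ.+<+ (s≤s z≤n)))
    compare₁ C (-[1+ p ] ∷ []) K = K tt tt (inj₁ (multiple≤0 p))

    module E₁ = Elimination {a} {1} ⊤ (λ _ _ → ⊤) tt (λ _ _ → tt) parameter≥0 Positive₁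
      positive⇒entails (λ _ _ e → e) (λ _ → Alternative F g) compare₁

    system : List (Form (m ℕ.+ 1))
    system = ((-1ℤ ⊠ g) ++ (1ℤ ∷ [])) ∷ mapᴸ (_++ (0ℤ ∷ [])) F

    evs-point : ∀ {m} (zs : Vec (Form 1) m) → evs B zs (c ∷ []) ≡ map (_• c) (map head zs)
    evs-point []                = refl
    evs-point ((k ∷ []) ∷ zs) = cong₂ _∷_ (solve (k • c ∷ []) (v₀ :+ :0) v₀ refl) (evs-point zs)

    farkas : Alternative F g
    farkas = E₁.decide m tt system λ
      -- A solution linear in `t` has one integer numerator for each unknown, and these form the
      -- point. The row `t ≤ g` becomes `β + 1 ≤ g`, whence strict positivity.
      { _ _ (inj₁ (β , zs , feas)) → inj₁ (map head zs , All.tabulate (λ {l} l∈ → row≤0 zs feas l∈) , goal>0 zs feas)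
      ; _ _ (inj₂ (k , pos , inf)) → inj₂ (entailed k pos inf) }
      where
      value : ∀ β (l : Form m) κ (zs : Vec (Form 1) m) →
        ev (substitute (+ suc β) (l ++ (κ ∷ [])) zs) (c ∷ []) ≡ (dot l (map head zs) ℤ.+ κ ℤ.* (+ suc β)) • c
      value β l κ zs = begin
        ev (substitute (+ suc β) (l ++ (κ ∷ [])) zs) (c ∷ [])
          ≡⟨ ev-substitute B (+ suc β) (l ++ (κ ∷ [])) zs (c ∷ []) ⟩
        ev (l ++ (κ ∷ [])) (evs B zs (c ∷ []) ++ ((+ suc β) • c ∷ []))
          ≡⟨ ev-++ l (κ ∷ []) _ _ ⟩
        ev l (evs B zs (c ∷ [])) + (κ • (+ suc β) • c + 0#)
          ≡⟨ cong₂ _+_ (trans (cong (ev l) (evs-point zs)) (ev-dot l (map head zs) c))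
               (trans (solve (κ • (+ suc β) • c ∷ []) (v₀ :+ :0) v₀ refl) (sym (•-assoc κ (+ suc β) c))) ⟩
        dot l (map head zs) • c + (κ ℤ.* (+ suc β)) • c
          ≡⟨ sym (•-distribʳ (dot l (map head zs)) (κ ℤ.* (+ suc β)) c) ⟩
        (dot l (map head zs) ℤ.+ κ ℤ.* (+ suc β)) • c ∎
        where open ≡-Reasoning

      integral : ∀ {β} (l : Form m) κ (zs : Vec (Form 1) m) →
        Entails a (parameter≥0 tt) (substitute (+ suc β) (l ++ (κ ∷ [])) zs) →
        dot l (map head zs) ℤ.+ κ ℤ.* (+ suc β) ℤ.≤ 0ℤ
      -- The entailment is tested in `B` at `t = c`, where it becomes an inequality of integers.
      integral {β} l κ zs e = •c-reflects-≤0 _ (≤-trans (≤-reflexive (sym (value β l κ zs)))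
        (Neg⇒≤0 (e B ≤-refl (≤0⇒Neg (≤-move 0≤c (solve (c ∷ []) (:0 :- v₀) ((-1ℤ :* v₀ :+ :0) :- :0) refl)) ∷ []))))

      row≤0 : ∀ {β} zs → (∀ {l} → l ∈ system → Entails a (parameter≥0 tt) (substitute (+ suc β) l zs)) →
        ∀ {l} → l ∈ F → dot l (map head zs) ℤ.≤ 0ℤ
      row≤0 {β} zs feas {l} l∈ = subst (ℤ._≤ 0ℤ) (ℤ.+-identityʳ (dot l (map head zs)))
        (integral {β} l 0ℤ zs (feas (there (∈-map⁺ (_++ (0ℤ ∷ [])) l∈))))

      goal>0 : ∀ {β} zs → (∀ {l} → l ∈ system → Entails a (parameter≥0 tt) (substitute (+ suc β) l zs)) →
        0ℤ ℤ.< dot g (map head zs)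
      goal>0 {β} zs feas = ℤ.<-≤-trans (ℤ.+<+ (s≤s z≤n)) (ℤ.i-j≤0⇒i≤j
        (subst (ℤ._≤ 0ℤ) rearrange (integral {β} (-1ℤ ⊠ g) 1ℤ zs (feas (here refl)))))
        where
        swap : ∀ d k → -1ℤ ℤ.* d ℤ.+ 1ℤ ℤ.* k ≡ k ℤ.- d
        swap = solve-∀
        rearrange : dot (-1ℤ ⊠ g) (map head zs) ℤ.+ 1ℤ ℤ.* (+ suc β) ≡ + suc β ℤ.- dot g (map head zs)
        rearrange = trans (cong (ℤ._+ 1ℤ ℤ.* (+ suc β)) (dot-⊠ -1ℤ g (map head zs))) (swap (dot g (map head zs)) (+ suc β))

      entailed : ∀ k → Positive₁ tt k →
        ((A : AbelianLGroup a) → let module S = Semantics A in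
          ∀ {h} {z : Vec S.Carrier m} {x} → S.0# S.≤ h → S.Below h (z ++ x) system → S.Neg h (S.ev k x)) →
        Entails a F g
      entailed (+ zero ∷ [])   (ℤ.+<+ ()) inf
      entailed (-[1+ p ] ∷ []) ()         inf
      -- The certificate `(p + 1) t ≤ 0` follows from `F ≤ 0` and `t ≤ g`. Taking for `t` the value
      -- of `g` itself yields `g ≤ 0`.
      entailed (+ suc p ∷ []) pos inf A {h} {ρ} 0≤h below = S.Neg-cancel p 0≤h
        (S.Neg-≡ (S.solve ((+ suc p) S.• t ∷ []) (v₀ :+ :0) v₀ refl) (inf A {z = ρ} {x = t ∷ []} 0≤h (goal-row ∷ rows)))
        where
        module S = Semantics A
        t = S.ev g ρ
        goal-row : S.Neg h (S.ev ((-1ℤ ⊠ g) ++ (1ℤ ∷ [])) (ρ ++ (t ∷ [])))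
        goal-row = S.≤0⇒Neg (S.≤-reflexive (trans (S.ev-++ (-1ℤ ⊠ g) (1ℤ ∷ []) ρ (t ∷ []))
          (trans (cong (S._+ (1ℤ S.• t S.+ S.0#)) (S.ev-neg g ρ))
            (S.solve (t ∷ []) (:- v₀ :+ (1ℤ :* v₀ :+ :0)) :0 refl))))
        rows : S.Below h (ρ ++ (t ∷ [])) (mapᴸ (_++ (0ℤ ∷ [])) F)
        rows = map⁺ (All.map (λ {l} → S.Neg-≡ (sym (trans (S.ev-++ l (0ℤ ∷ []) ρ (t ∷ []))
          (S.solve (S.ev l ρ ∷ t ∷ []) (v₀ :+ (0ℤ :* v₁ :+ :0)) v₀ refl)))) below)

-- Divisibility

Divisible : ∀ {a} → AbelianLGroup a → ℕ → Set a
Divisible A k = ∀ y → Σ Carrier λ w → (+ k) • w ≡ y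
  where open Semantics A

DivisibilityCondition : ∀ {a} → (AbelianLGroup a → Set a) → Set (lsuc a)
DivisibilityCondition {a} P = Σ ℕ λ d → (A : AbelianLGroup a) → P A ⇔ Divisible A (suc d)

-- This merges finitely many divisibility conditions into one. For the converse, `q` times a
-- `p q`-th part of `y` is a `p`-th part of `y`.
Divisible-* : ∀ {a} (A : AbelianLGroup a) p q →
  (Divisible A p × Divisible A q) ⇔ Divisible A (p ℕ.* q)
Divisible-* A p q = mk⇔ to from
  where
  open Semantics A
  •-*ℕ : ∀ p q w → (+ (p ℕ.* q)) • w ≡ (+ p) • (+ q) • w
  •-*ℕ p q w = trans (cong (_• w) (ℤ.pos-* p q)) (•-assoc (+ p) (+ q) w)
  to : Divisible A p × Divisible A q → Divisible A (p ℕ.* q)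
  to (dp , dq) y with dp y
  ... | w , pw≡y with dq w
  ... | v , qv≡w = v , trans (•-*ℕ p q v) (trans (cong ((+ p) •_) qv≡w) pw≡y)
  from : Divisible A (p ℕ.* q) → Divisible A p × Divisible A q
  from d = (λ y → let w , eq = d y in (+ q) • w , trans (sym (•-*ℕ p q w)) eq)
         , (λ y → let w , eq = d y in (+ p) • w , trans (•-comm (+ q) (+ p) w) (trans (sym (•-*ℕ p q w)) eq))

DivisibilityCondition-∀ : ∀ {a n} {P : Fin n → AbelianLGroup a → Set a} →
  (∀ i → DivisibilityCondition (P i)) → DivisibilityCondition (λ A → ∀ i → P i A)
DivisibilityCondition-∀ {n = zero} conds = 0 , λ A → mk⇔ (λ _ y → y , Semantics.•-identity A y) (λ _ ())
DivisibilityCondition-∀ {n = suc n} {P} conds with conds zero | DivisibilityCondition-∀ {P = λ i → P (suc i)} (λ i → conds (suc i))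
... | d , eq | e , eqs = e ℕ.+ d ℕ.* suc e , λ A → mk⇔
  (λ h → Equivalence.to (Divisible-* A (suc d) (suc e))
    (Equivalence.to (eq A) (h zero) , Equivalence.to (eqs A) (λ i → h (suc i))))
  (λ h → let hd , he = Equivalence.from (Divisible-* A (suc d) (suc e)) h in
    λ { zero → Equivalence.from (eq A) hd ; (suc i) → Equivalence.from (eqs A) he i })

Solvable : ∀ {a} → ℕ → ℤ → AbelianLGroup a → Set a
Solvable p k A = ∀ y → Σ Carrier λ w → (+ p) • w ≡ k • y
  where open Semantics A

•-cancel : ∀ {a} (A : AbelianLGroup a) → let open Semantics A in
  ∀ n {x y} → (+ suc n) • x ≡ (+ suc n) • y → x ≡ y
•-cancel A n {x} {y} eq = ≤-antisym (half eq) (half (sym eq))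
  where
  open Semantics A
  half : ∀ {x y} → (+ suc n) • x ≡ (+ suc n) • y → x ≤ y
  half {x} {y} eq = x-y≤0⇒x≤y (•-cancel-≤0 n (≤-trans (≤-reflexive (•-distrib-- A (+ suc n) x y))
    (x≤y⇒x-y≤0 (≤-reflexive eq))))

bézout : ∀ p k → Σ ℕ λ g → Σ ℕ λ d → Σ ℤ λ κ → Σ ℤ λ r → Σ ℤ λ s →
  (+ suc p ≡ (+ suc d) ℤ.* (+ suc g)) × (k ≡ κ ℤ.* (+ suc g)) × (+ suc g ≡ r ℤ.* (+ suc p) ℤ.+ s ℤ.* k)
bézout p k with Bézout.lemma (suc p) ℤ.∣ k ∣
... | Bézout.result g isGCD identity with GCD.gcd∣m isGCD | GCD.gcd∣n isGCD
-- A gcd equal to 0 would force `p + 1` to be 0.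
bézout p k | Bézout.result zero isGCD identity | divides q eq | _ with trans eq (ℕ.*-zeroʳ q)
... | ()
bézout p k | Bézout.result (suc g) isGCD identity | divides (suc d) eq | divides c k-eq =
  let r , s , comb = integral identity
      σ , ∣k∣≡σk , k≡σ∣k∣ = signed k
  in g , d , σ ℤ.* (+ c) , r , s ℤ.* σ ,
    trans (cong +_ eq) (ℤ.pos-* (suc d) (suc g)) ,
    trans k≡σ∣k∣ (trans (cong (σ ℤ.*_) (trans (cong +_ k-eq) (ℤ.pos-* c (suc g)))) (sym (ℤ.*-assoc σ (+ c) (+ suc g)))) ,
    trans comb (cong (λ t → r ℤ.* (+ suc p) ℤ.+ t) (trans (cong (s ℤ.*_) ∣k∣≡σk) (sym (ℤ.*-assoc s σ k))))
  where
  -- The gcd is taken with the absolute value of `k`; the sign `σ` goes into the cofactor and the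
  -- Bézout coefficient.
  signed : ∀ k → Σ ℤ λ σ → (+ ℤ.∣ k ∣ ≡ σ ℤ.* k) × (k ≡ σ ℤ.* (+ ℤ.∣ k ∣))
  signed (+ n)    = 1ℤ , sym (ℤ.*-identityˡ (+ n)) , sym (ℤ.*-identityˡ (+ n))
  signed -[1+ n ] = -1ℤ , sym (ℤ.-1*i≡-i -[1+ n ]) , sym (ℤ.-1*i≡-i (+ suc n))

  cancelʳ : ∀ i j l m → i ℤ.+ j ℤ.* l ≡ m → i ≡ m ℤ.+ (ℤ.- j) ℤ.* l
  cancelʳ i j l m refl = ring i j l
    where
    ring : ∀ i j l → i ≡ (i ℤ.+ j ℤ.* l) ℤ.+ (ℤ.- j) ℤ.* l
    ring = solve-∀

  cast : ∀ {g x m y n} → g ℕ.+ y ℕ.* n ≡ x ℕ.* m → + g ℤ.+ (+ y) ℤ.* (+ n) ≡ (+ x) ℤ.* (+ m)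
  cast {g} {x} {m} {y} {n} eq = trans (cong (λ t → + g ℤ.+ t) (sym (ℤ.pos-* y n)))
    (trans (sym (ℤ.pos-+ g (y ℕ.* n))) (trans (cong +_ eq) (ℤ.pos-* x m)))

  integral : ∀ {g m n} → Bézout.Identity g m n → Σ ℤ λ r → Σ ℤ λ s → + g ≡ r ℤ.* (+ m) ℤ.+ s ℤ.* (+ n)
  integral {g} {m} {n} (Bézout.+- x y eq) = + x , ℤ.- (+ y) ,
    cancelʳ (+ g) (+ y) (+ n) _ (cast {g} {x} {m} {y} {n} eq)
  integral {g} {m} {n} (Bézout.-+ x y eq) = ℤ.- (+ x) , + y ,
    trans (cancelʳ (+ g) (+ x) (+ m) _ (cast {g} {y} {n} {x} {m} eq)) (ℤ.+-comm ((+ y) ℤ.* (+ n)) _)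

-- p w = k y is solvable for all y exactly when A is divisible by p / gcd (p , k):
-- if gcd (p , k) = r p + s k, then (p / gcd (p , k)) (r y + s w) = y.
Solvable-condition : ∀ {a} p k → DivisibilityCondition {a} (Solvable (suc p) k)
Solvable-condition p k with bézout p k
... | g , d , κ , r , s , p≡dg , k≡κg , g≡rp+sk = d , λ A → mk⇔ (to A) (from A)
  where
  P = + suc p
  D = + suc d
  G = + suc g
  to : ∀ A → Solvable (suc p) k A → Divisible A (suc d)
  to A sol y = let w , Pw≡ky = sol y in r • y + s • w , •-cancel A g (begin
    G • D • (r • y + s • w)      ≡⟨ trans (•-comm G D _) (sym (•-assoc D G _)) ⟩
    (D ℤ.* G) • (r • y + s • w)  ≡⟨ cong (_• (r • y + s • w)) (sym p≡dg) ⟩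
    P • (r • y + s • w)          ≡⟨ •-distribˡ P _ _ ⟩
    P • r • y + P • s • w        ≡⟨ cong₂ _+_ (•-comm P r y) (trans (•-comm P s w) (cong (s •_) Pw≡ky)) ⟩
    r • P • y + s • k • y        ≡⟨ cong₂ _+_ (sym (•-assoc r P y)) (sym (•-assoc s k y)) ⟩
    (r ℤ.* P) • y + (s ℤ.* k) • y ≡⟨ sym (•-distribʳ (r ℤ.* P) (s ℤ.* k) y) ⟩
    (r ℤ.* P ℤ.+ s ℤ.* k) • y    ≡⟨ cong (_• y) (sym g≡rp+sk) ⟩
    G • y                        ∎)
    where
    open Semantics A
    open ≡-Reasoning
  from : ∀ A → Divisible A (suc d) → Solvable (suc p) k A
  from A div y = let v , Dv≡y = div y in κ • v , (begin
    P • κ • v            ≡⟨ cong (_• κ • v) p≡dg ⟩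
    (D ℤ.* G) • κ • v    ≡⟨ •-assoc D G _ ⟩
    D • G • κ • v        ≡⟨ cong (D •_) (trans (•-comm G κ v) (sym (•-assoc κ G v))) ⟩
    D • (κ ℤ.* G) • v    ≡⟨ cong (λ i → D • i • v) (sym k≡κg) ⟩
    D • k • v            ≡⟨ •-comm D k v ⟩
    k • D • v            ≡⟨ cong (k •_) Dv≡y ⟩
    k • y                ∎)
    where
    open Semantics A
    open ≡-Reasoning

ev-solvable : ∀ {a n} (A : AbelianLGroup a) p (l : Form n) → (∀ j → Solvable p (lookup l j) A) →
  let open Semantics A in ∀ x → Σ Carrier λ w → (+ p) • w ≡ ev l x
ev-solvable A p []      sol []      = 0# , •-0# (+ p)
  where open Semantics A
ev-solvable A p (k ∷ l) sol (y ∷ x) =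
  let w , eq = sol zero y
      v , eq′ = ev-solvable A p l (λ j → sol (suc j)) x
  in w + v , trans (•-distribˡ (+ p) w v) (cong₂ _+_ eq eq′)
  where open Semantics A

-- This reads a form in `(z , x)` as one in `(z , z′ , x)`, so that two solutions over the same
-- parameters satisfy one linear system.
insertZeros : ∀ m k {n} → Form (m ℕ.+ n) → Form (m ℕ.+ (k ℕ.+ n))
insertZeros zero    k l       = 𝟎 {k} ++ l
insertZeros (suc m) k (i ∷ l) = i ∷ insertZeros m k l

ev-insertZeros : ∀ {a} (A : AbelianLGroup a) → let open Semantics A in
  ∀ {m k n} (l : Form (m ℕ.+ n)) (z : Vec Carrier m) (z′ : Vec Carrier k) (x : Vec Carrier n) →
  ev (insertZeros m k l) (z ++ (z′ ++ x)) ≡ ev l (z ++ x)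
ev-insertZeros A {k = k} l [] z′ x = trans (ev-++ (𝟎 {k}) l z′ x) (trans (cong (_+ ev l x) (ev-𝟎 z′))
  (solve (ev l x ∷ []) (:0 :+ v₀) v₀ refl))
  where open Semantics A
ev-insertZeros A (i ∷ l) (y ∷ z) z′ x = cong (λ u → i • y + u) (ev-insertZeros A l z z′ x)
  where open Semantics A

bound : ∀ {n} (F : List (Form n)) (u : Vec ℤ n) → Σ ℕ λ M → ∀ {l} → l ∈ F → ℤ.∣ dot l u ∣ ℕ.≤ M
bound []      u = 0 , λ ()
bound (k ∷ F) u = let M , le = bound F u in ℤ.∣ dot k u ∣ ℕ.+ M ,
  λ { (here refl) → ℕ.m≤m+n _ M ; (there l∈) → ℕ.≤-trans (le l∈) (ℕ.m≤n+m M _) }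

-- The reduction of an EFD-sentence to divisibility

module _ {a} (φ : EFD) (B : AbelianLGroup a) (B⊨φ : Models B φ)
         (b : AbelianLGroup.Carrier B) (b≢0 : ¬ (b ≡ AbelianLGroup.0# B)) where

  n m : ℕ
  n = EFD.n φ
  m = suc (EFD.m' φ)

  eqs : Eqs (n ℕ.+ m)
  eqs = EFD.eqs φ

  -- φ lists the parameters first; the forms below list the unknowns first, so that they are eliminated first.
  σ : Fin (n ℕ.+ m) → Form (m ℕ.+ n)
  σ i = [ (λ j → unit (m ↑ʳ j)) , (λ j → unit (j ↑ˡ n)) ]′ (splitAt n i)

  solutionCones : List (List (Form (m ℕ.+ n)))
  solutionCones = Pieces.cones σ eqs

  module _ (A : AbelianLGroup a) where
    open Semantics A

    σ-correct : (x : Vec Carrier n) (z : Vec Carrier m) → ∀ i → ev (σ i) (z ++ x) ≡ lookup (x ++ z) i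
    σ-correct x z i = trans (aux (splitAt n i)) (sym (lookup-splitAt n x z i))
      where
      aux : ∀ s → ev ([ (λ j → unit (m ↑ʳ j)) , (λ j → unit (j ↑ˡ n)) ]′ s) (z ++ x) ≡ [ lookup x , lookup z ]′ s
      aux (inj₁ j) = trans (ev-unit (m ↑ʳ j) (z ++ x)) (lookup-++ʳ z x j)
      aux (inj₂ j) = trans (ev-unit (j ↑ˡ n) (z ++ x)) (lookup-++ˡ z x j)

    sound : ∀ x z {h c} → 0# ≤ h → c ∈ solutionCones → Below h (z ++ x) c → Holds h (x ++ z) eqs
    sound x z = cones-sound σ (σ-correct x z) eqs

    cover : ∀ x z {h g} → 0# ≤ h → Holds h (x ++ z) eqs → Covers h (z ++ x) g solutionCones
    cover x z = cones-cover σ (σ-correct x z) eqs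

    Sat⇒Holds : ∀ x z → Sat A φ x z → Holds 0# (x ++ z) eqs
    Sat⇒Holds x z = All.map ≈-≡

    Holds⇒Sat : ∀ x z → Holds 0# (x ++ z) eqs → Sat A φ x z
    Holds⇒Sat x z = All.map ≈⇒≡

    Holds-congʳ : ∀ {h} {x : Vec Carrier n} {z z′ : Vec Carrier m} → 0# ≤ h →
      (∀ i → lookup z i ≈[ h ] lookup z′ i) → Holds h (x ++ z) eqs → Holds h (x ++ z′) eqs
    Holds-congʳ {h} {x} {z} {z′} 0≤h eq = Holds-cong {ρ = x ++ z} {x ++ z′} 0≤h λ i →
      ≈-trans (≈-≡ (lookup-splitAt n x z i))
        (≈-trans (aux (splitAt n i)) (≈-≡ (sym (lookup-splitAt n x z′ i))))
      where
      aux : ∀ s → [ lookup x , lookup z ]′ s ≈[ h ] [ lookup x , lookup z′ ]′ s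
      aux (inj₁ j) = ≈-refl
      aux (inj₂ j) = eq j

    difference-value : ∀ i (z z′ : Vec Carrier m) (x : Vec Carrier n) →
      ev (unit i ++ ((-1ℤ ⊠ unit i) ++ 𝟎)) (z ++ (z′ ++ x)) ≡ lookup z i - lookup z′ i
    difference-value i z z′ x = trans (ev-++ (unit i) _ z (z′ ++ x)) (cong₂ _+_ (ev-unit i z)
      (trans (ev-++ (-1ℤ ⊠ unit i) 𝟎 z′ x) (trans (cong₂ _+_ (trans (ev-neg (unit i) z′) (cong -_ (ev-unit i z′))) (ev-𝟎 x))
        (solve (lookup z′ i ∷ []) (:- v₀ :+ :0) (:- v₀) refl))))

    ev-second : ∀ (l : Form (m ℕ.+ n)) (z z′ : Vec Carrier m) (x : Vec Carrier n) →
      ev (𝟎 {m} ++ l) (z ++ (z′ ++ x)) ≡ ev l (z′ ++ x)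
    ev-second l z z′ x = trans (ev-++ (𝟎 {m}) l z (z′ ++ x)) (trans (cong (_+ ev l (z′ ++ x)) (ev-𝟎 z))
      (solve (ev l (z′ ++ x) ∷ []) (:0 :+ v₀) v₀ refl))

  open Integers B b b≢0 using (c; 0≤c; c≰0; •c-reflects-≤0; farkas)

  -- Uniqueness passes from B to every ℓ-group: a violation would give an integer point of a rational
  -- cone, hence a violation inside B.

  two-solutions : List (Form (m ℕ.+ n)) → List (Form (m ℕ.+ n)) → List (Form (m ℕ.+ (m ℕ.+ n)))
  two-solutions p q = mapᴸ (insertZeros m m) p ++ᴸ mapᴸ (𝟎 {m} ++_) q

  difference : Fin m → Form (m ℕ.+ (m ℕ.+ n))
  difference i = unit i ++ ((-1ℤ ⊠ unit i) ++ 𝟎)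

  difference≤0 : ∀ {p q} → p ∈ solutionCones → q ∈ solutionCones → ∀ i → Entails a (two-solutions p q) (difference i)
  difference≤0 {p} {q} p∈ q∈ i with farkas (two-solutions p q) (difference i)
  ... | inj₂ e = e
  ... | inj₁ (v , below , positive) with Data.Vec.splitAt m v
  ... | u , w , refl with Data.Vec.splitAt m w
  -- The integer point gives two solutions among the multiples of `c` over the same parameters. They
  -- coincide in `B`, so their difference is 0, against positivity.
  ... | u′ , t , refl = ⊥-elim (ℤ.<⇒≱ positive (•c-reflects-≤0 _ (≤-reflexive difference≡0)))
    where
    open Semantics B
    z  = map (_• c) u
    z′ = map (_• c) u′
    x  = map (_• c) t

    scaled : map (_• c) (u ++ (u′ ++ t)) ≡ z ++ (z′ ++ x)
    scaled = trans (map-++ (_• c) u (u′ ++ t)) (cong (z ++_) (map-++ (_• c) u′ t))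

    value : ∀ l → ev l (z ++ (z′ ++ x)) ≡ dot l (u ++ (u′ ++ t)) • c
    value l = trans (cong (ev l) (sym scaled)) (ev-dot l (u ++ (u′ ++ t)) c)

    row : ∀ {l} → l ∈ two-solutions p q → Neg 0# (ev l (z ++ (z′ ++ x)))
    row {l} l∈ = Neg-≡ (sym (value l)) (≤0⇒Neg (Nonneg.•-nonpos B 0≤c (All.lookup below l∈)))

    holds : Holds 0# (x ++ z) eqs
    holds = sound B x z ≤-refl p∈ (All.tabulate λ {l} l∈ →
      Neg-≡ (ev-insertZeros B l z z′ x) (row (∈-++⁺ˡ (∈-map⁺ (insertZeros m m) l∈))))

    holds′ : Holds 0# (x ++ z′) eqs
    holds′ = sound B x z′ ≤-refl q∈ (All.tabulate λ {l} l∈ →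
      Neg-≡ (ev-second B l z z′ x) (row (∈-++⁺ʳ (mapᴸ (insertZeros m m) p) (∈-map⁺ (𝟎 {m} ++_) l∈))))

    z≡z′ : z ≡ z′
    z≡z′ = let _ , _ , uniq = B⊨φ x in trans (uniq z (Holds⇒Sat B x z holds)) (sym (uniq z′ (Holds⇒Sat B x z′ holds′)))

    difference≡0 : dot (difference i) (u ++ (u′ ++ t)) • c ≡ 0#
    difference≡0 = trans (sym (value (difference i))) (trans (difference-value B i z z′ x)
      (trans (cong (λ s → lookup s i - lookup z′ i) z≡z′) (solve (lookup z′ i ∷ []) (v₀ :- v₀) :0 refl)))

  -- After enlarging `h` twice both solutions lie in cones, and `difference≤0` for these cones
  -- bounds each difference of coordinates; exchanging the solutions bounds its opposite.
  unique : (A : AbelianLGroup a) → let open Semantics A in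
    ∀ {h} x z z′ → 0# ≤ h → Holds h (x ++ z) eqs → Holds h (x ++ z′) eqs → ∀ i → lookup z i ≈[ h ] lookup z′ i
  unique A {h} x z z′ 0≤h holds holds′ i = half z z′ holds holds′ , half z′ z holds′ holds
    where
    open Semantics A
    half : ∀ z z′ → Holds h (x ++ z) eqs → Holds h (x ++ z′) eqs → Neg h (lookup z i - lookup z′ i)
    half z z′ holds holds′ = cover A x z 0≤h holds λ {p} {k} p∈ h≤k below →
      let 0≤k = ≤-trans 0≤h h≤k in
      cover A x z′ 0≤k (Holds-weaken h≤k holds′) λ {q} {k′} q∈ k≤k′ below′ →
      Neg-≡ (difference-value A i z z′ x) (difference≤0 p∈ q∈ i A (≤-trans 0≤k k≤k′)
        (++⁺ (map⁺ (All.map (λ {l} s → Neg-weaken k≤k′ (Neg-≡ (sym (ev-insertZeros A l z z′ x)) s)) below))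
             (map⁺ (All.map (λ {l} → Neg-≡ (sym (ev-second A l z z′ x))) below′))))

  -- Necessity is global, while sufficiency concerns the parameters in the cone `F`, modulo every
  -- `h` as gluing demands. For empty `F` and `h = 0` the two halves become converse to each other.
  Reduction : List (Form n) → Set (lsuc a)
  Reduction F = Σ ℕ λ d →
    ((A : AbelianLGroup a) → Models A φ → Divisible A (suc d)) ×
    ((A : AbelianLGroup a) → Divisible A (suc d) → let open Semantics A in
      ∀ {h} x → 0# ≤ h → Below h x F → Σ (Vec Carrier m) λ z → Holds h (x ++ z) eqs)

  cut : ∀ {F} g → Entails a F g → Reduction (g ∷ F) → Reduction F
  cut g e (d , necessary , sufficient) = d , necessary , λ A div x 0≤h below →
    sufficient A div x 0≤h (e A 0≤h below ∷ below)

  split : ∀ {F} g → Reduction (g ∷ F) → Reduction ((-1ℤ ⊠ g) ∷ F) → Reduction F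
  split {F} g (d , necessary₁ , sufficient₁) (e , necessary₂ , sufficient₂) = e ℕ.+ d ℕ.* suc e ,
    (λ A A⊨φ → Equivalence.to (Divisible-* A (suc d) (suc e)) (necessary₁ A A⊨φ , necessary₂ A A⊨φ)) ,
    λ A div → let div₁ , div₂ = Equivalence.from (Divisible-* A (suc d) (suc e)) div in glued A div₁ div₂
    where
    glued : (A : AbelianLGroup a) → Divisible A (suc d) → Divisible A (suc e) → let open Semantics A in
      ∀ {h} x → 0# ≤ h → Below h x F → Σ (Vec Carrier m) λ z → Holds h (x ++ z) eqs
    -- `z` agrees with `z₁` modulo `p` and with `z₂` modulo `q`, so it solves the equations modulo
    -- both, hence modulo `h`.
    glued A div₁ div₂ {h} x 0≤h below = z , Holds-split y 0≤h
      (Holds-congʳ A {x = x} {z₁} {z} 0≤p (λ i → ≈-sym (near₁ i)) holds₁)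
      (Holds-congʳ A {x = x} {z₂} {z} 0≤q (λ i → ≈-sym (near₂ i)) holds₂)
      where
      open Semantics A
      y = ev g x
      p = h + y ⁺
      q = h + (- y) ⁺
      0≤p = +-nonneg 0≤h (⁺-nonneg y)
      0≤q = +-nonneg 0≤h (⁺-nonneg (- y))
      solution₁ = sufficient₁ A div₁ x 0≤p (Neg-⁺ y 0≤h ∷ Below-weaken (x≤x+y (⁺-nonneg y)) below)
      solution₂ = sufficient₂ A div₂ x 0≤q (Neg-≡ (sym (ev-neg g x)) (Neg-⁺ (- y) 0≤h)
        ∷ Below-weaken (x≤x+y (⁺-nonneg (- y))) below)
      z₁ = proj₁ solution₁
      z₂ = proj₁ solution₂
      holds₁ = proj₂ solution₁
      holds₂ = proj₂ solution₂
      glueing : ∀ i → Σ Carrier λ w → (w ≈[ p ] lookup z₁ i) × (w ≈[ q ] lookup z₂ i)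
      -- Modulo `p + q` both `z₁` and `z₂` are solutions, and uniqueness there gives the congruence
      -- that gluing requires.
      glueing i = glue 0≤p 0≤q (unique A x z₁ z₂ (+-nonneg 0≤p 0≤q)
        (Holds-weaken (x≤x+y 0≤q) holds₁) (Holds-weaken (x≤y+x 0≤p) holds₂) i)
      z = tabulate λ i → proj₁ (glueing i)
      near₁ : ∀ i → lookup z i ≈[ p ] lookup z₁ i
      near₁ i = ≈-trans (≈-≡ (lookup∘tabulate (λ i → proj₁ (glueing i)) i)) (proj₁ (proj₂ (glueing i)))
      near₂ : ∀ i → lookup z i ≈[ q ] lookup z₂ i
      near₂ i = ≈-trans (≈-≡ (lookup∘tabulate (λ i → proj₁ (glueing i)) i)) (proj₂ (proj₂ (glueing i)))

  -- Recording `- g` among the forms gives `g ≥ 0` on the cell and, as all forms are negative at the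
  -- interior point, `g > 0` there.
  Positive : Cell n → Form n → Set
  Positive C g = (-1ℤ ⊠ g) ∈ forms C

  -- If neither sign of `g` is entailed, the hyperplane `g = 0` cuts the cell into two that are
  -- again full-dimensional. If only `g ≥ 0` is entailed, `- g` is added to the cell and `cut`
  -- removes it again.
  compare : ∀ C g → (∀ D → C ≼ D → Entails a (forms D) g ⊎ Positive D g → Reduction (forms D)) → Reduction (forms C)
  compare C g K with farkas (forms C) g
  ... | inj₂ e = K C (λ l∈ → l∈) (inj₁ e)
  ... | inj₁ (u , below , g>0) with farkas (forms C) (-1ℤ ⊠ g)
  ... | inj₂ e = cut (-1ℤ ⊠ g) e (K (extend C (-1ℤ ⊠ g) below (neg-positive g u g>0)) there (inj₂ (here refl)))
  ... | inj₁ (w , below′ , g<0) = split g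
    (K (extend C g below′ (negative-pos g w g<0)) there (inj₁ (Entails-∈ {g = g} (here refl))))
    (K (extend C (-1ℤ ⊠ g) below (neg-positive g u g>0)) there (inj₂ (here refl)))

  open Elimination {a} {n} (Cell n) _≼_ (λ l∈ → l∈) (λ C≼D D≼E l∈ → D≼E (C≼D l∈)) forms Positive
    (λ {C} {g} pos → Entails-∈ {g = -1ℤ ⊠ g} pos) (λ C≼D g → Entails-mono C≼D g)
    (λ C → Reduction (forms C)) compare

  -- Divisibility on a cell with a linear solution.

  module LinearSolution (C : Cell n) {p} (p∈ : p ∈ solutionCones) (β : ℕ) (zs : Vec (Form n) m)
                        (feasible : ∀ {l} → l ∈ p → C ⊢ substitute (+ suc β) l zs) where

    module _ (A : AbelianLGroup a) where
      open Semantics A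

      scale : ∀ {k} → Vec Carrier k → Vec Carrier k
      scale = map ((+ suc β) •_)

      holds-linear : ∀ {h x} → 0# ≤ h → Below h x (forms C) → Holds h (scale x ++ evs A zs x) eqs
      holds-linear {h} {x} 0≤h below = sound A (scale x) (evs A zs x) 0≤h p∈ (All.tabulate λ {l} l∈ →
        Neg-≡ (ev-substitute A (+ suc β) l zs x) (feasible l∈ A 0≤h below))

      -- If (x , z) is a solution then so is its multiple by β + 1, which uniqueness compares with
      -- the linear solution.
      solution-linear : ∀ {h x z} → 0# ≤ h → Below h x (forms C) → Holds h (x ++ z) eqs →
        ∀ i → ((+ suc β) • lookup z i) ≈[ h ] ev (lookup zs i) x
      solution-linear {h} {x} {z} 0≤h below holds i = at proj₁ , at proj₂
        where
        both : ∀ {q k} → q ∈ solutionCones → h ≤ k → Below k (z ++ x) q →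
          ((+ suc β) • lookup z i) ≈[ k ] ev (lookup zs i) x
        both {q} {k} q∈ h≤k below′ = ≈-trans (≈-≡ (sym (lookup-map i ((+ suc β) •_) z)))
          (≈-trans (unique A (scale x) (scale z) (evs A zs x) 0≤k
            (sound A (scale x) (scale z) 0≤k q∈ (All.map (λ {l} s → Neg-≡ (scaled l) (Neg-• (suc β) s)) below′))
            (holds-linear 0≤k (Below-weaken h≤k below)) i)
            (≈-≡ (lookup-map i (λ f → ev f x) zs)))
          where
          0≤k = ≤-trans 0≤h h≤k
          scaled : ∀ l → (+ suc β) • ev l (z ++ x) ≡ ev l (scale z ++ scale x)
          scaled l = trans (sym (ev-map (+ suc β) l (z ++ x))) (cong (ev l) (map-++ ((+ suc β) •_) z x))
        at : ∀ {s} → (∀ {k} → ((+ suc β) • lookup z i) ≈[ k ] ev (lookup zs i) x → Neg k s) → Neg h s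
        at f = cover A x z 0≤h holds λ q∈ h≤k below′ → f (both q∈ h≤k below′)

      sufficient : (∀ i j → Solvable (suc β) (lookup (lookup zs i) j) A) →
        ∀ {h} x → 0# ≤ h → Below h x (forms C) → Σ (Vec Carrier m) λ z → Holds h (x ++ z) eqs
      -- The coordinates of `z` are quotients by `β + 1`; the inequalities of the cone hold after
      -- multiplication by `β + 1`, which is then cancelled.
      sufficient sol {h} x 0≤h below = z , sound A x z 0≤h p∈ (All.tabulate λ {l} l∈ → Neg-cancel β 0≤h
        (Neg-≡ (value l) (feasible l∈ A 0≤h below)))
        where
        solved : ∀ i → Σ Carrier λ w → (+ suc β) • w ≡ ev (lookup zs i) x
        solved i = ev-solvable A (suc β) (lookup zs i) (sol i) x
        z = tabulate λ i → proj₁ (solved i)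
        scale-tabulate : ∀ {k} (gs : Vec (Form n) k) (f : Fin k → Carrier) →
          (∀ i → (+ suc β) • f i ≡ ev (lookup gs i) x) → evs A gs x ≡ scale (tabulate f)
        scale-tabulate []       f eq = refl
        scale-tabulate (g ∷ gs) f eq = cong₂ _∷_ (sym (eq zero)) (scale-tabulate gs (λ i → f (suc i)) (λ i → eq (suc i)))
        value : ∀ l → ev (substitute (+ suc β) l zs) x ≡ (+ suc β) • ev l (z ++ x)
        value l = trans (ev-substitute A (+ suc β) l zs x)
          (trans (cong (λ t → ev l (t ++ scale x)) (scale-tabulate zs (λ i → proj₁ (solved i)) (λ i → proj₂ (solved i))))
            (trans (cong (ev l) (sym (map-++ ((+ suc β) •_) z x))) (ev-map (+ suc β) l (z ++ x))))

      module _ (A⊨φ : Models A φ) where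

        -- The sentence supplies a solution at the parameters `u y`. By `solution-linear` its
        -- multiple by `β + 1` is the linear form at `u y`, an integer multiple of `y`.
        integer-point : ∀ {y} u → 0# ≤ y → (∀ {l} → l ∈ forms C → dot l u ℤ.≤ 0ℤ) →
          ∀ i → Σ Carrier λ w → (+ suc β) • w ≡ dot (lookup zs i) u • y
        integer-point {y} u 0≤y below i =
          let z , sat , _ = A⊨φ (map (_• y) u) in
          lookup z i , trans (≈⇒≡ (solution-linear {x = map (_• y) u} {z} ≤-refl
              (All.tabulate λ {l} l∈ → Neg-≡ (sym (ev-dot l u y)) (≤0⇒Neg (Nonneg.•-nonpos A 0≤y (below l∈))))
              (Sat⇒Holds A (map (_• y) u) z sat) i))
            (ev-dot (lookup zs i) u y)

        -- The coefficient at xⱼ is the difference of the values at two integer points of the cell, M v + eⱼ and M v.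
        solvable-nonneg : ∀ i j {y} → 0# ≤ y → Σ Carrier λ w → (+ suc β) • w ≡ lookup (lookup zs i) j • y
        solvable-nonneg i j {y} 0≤y = w - (+ M) • w′ , (begin
          (+ suc β) • (w - (+ M) • w′)
            ≡⟨ •-distrib-- A (+ suc β) w _ ⟩
          (+ suc β) • w - (+ suc β) • (+ M) • w′
            ≡⟨ cong₂ _-_ eq (trans (•-comm (+ suc β) (+ M) w′) (cong ((+ M) •_) eq′)) ⟩
          dot f ((+ M) ⊠ v ⊞ unit j) • y - (+ M) • dot f v • y
            ≡⟨ cong (λ k → k • y - (+ M) • dot f v • y) (trans (dot-affine (+ M) f v (unit j))
                 (cong (λ k → (+ M) ℤ.* dot f v ℤ.+ k) (dot-unit f j))) ⟩
          ((+ M) ℤ.* dot f v ℤ.+ lookup f j) • y - (+ M) • dot f v • y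
            ≡⟨ cong (_- (+ M) • dot f v • y) (trans (•-distribʳ ((+ M) ℤ.* dot f v) (lookup f j) y)
                 (cong (_+ lookup f j • y) (•-assoc (+ M) (dot f v) y))) ⟩
          ((+ M) • dot f v • y + lookup f j • y) - (+ M) • dot f v • y
            ≡⟨ solve ((+ M) • dot f v • y ∷ lookup f j • y ∷ []) ((v₀ :+ v₁) :- v₀) v₁ refl ⟩
          lookup f j • y ∎)
          where
          open ≡-Reasoning
          f = lookup zs i
          v = point C
          -- `M` bounds the absolute values of all forms of the cell at `eⱼ`; as these forms are
          -- negative at `v`, the point `M v + eⱼ` stays in the cell.
          M = proj₁ (bound (forms C) (unit j))
          inside : ∀ {l} → l ∈ forms C → dot l ((+ M) ⊠ v ⊞ unit j) ℤ.≤ 0ℤ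
          inside {l} l∈ = subst (ℤ._≤ 0ℤ) (sym (dot-affine (+ M) l v (unit j)))
            (dominated (dot l (unit j)) (All.lookup (interior C) l∈) (proj₂ (bound (forms C) (unit j)) l∈))
          at-u = integer-point ((+ M) ⊠ v ⊞ unit j) 0≤y inside i
          at-v = integer-point v 0≤y (λ l∈ → ℤ.<⇒≤ (All.lookup (interior C) l∈)) i
          w  = proj₁ at-u
          w′ = proj₁ at-v
          eq  = proj₂ at-u
          eq′ = proj₂ at-v

        solvable : ∀ i j → Solvable (suc β) (lookup (lookup zs i) j) A
        -- An arbitrary `y` is the difference of its positive and negative parts.
        solvable i j y =
          let k = lookup (lookup zs i) j
              w , eq   = solvable-nonneg i j (⁺-nonneg y)
              w′ , eq′ = solvable-nonneg i j (⁺-nonneg (- y))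
          in w - w′ , (begin
            (+ suc β) • (w - w′)               ≡⟨ •-distrib-- A (+ suc β) w w′ ⟩
            (+ suc β) • w - (+ suc β) • w′     ≡⟨ cong₂ _-_ eq eq′ ⟩
            k • y ⁺ - k • (- y) ⁺              ≡⟨ sym (•-distrib-- A k (y ⁺) _) ⟩
            k • (y ⁺ - (- y) ⁺)                ≡⟨ cong (λ t → k • (t - (- y) ⁺)) (⁺-decomp y) ⟩
            k • ((y + (- y) ⁺) - (- y) ⁺)      ≡⟨ cong (k •_) (solve (y ∷ (- y) ⁺ ∷ []) ((v₀ :+ v₁) :- v₁) v₀ refl) ⟩
            k • y                              ∎)
          where open ≡-Reasoning

    reduction : Reduction (forms C)
    reduction = let d , iff = DivisibilityCondition-∀ (λ i → DivisibilityCondition-∀ (λ j →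
                                Solvable-condition β (lookup (lookup zs i) j)))
      in d , (λ A A⊨φ → Equivalence.to (iff A) (solvable A A⊨φ))
           , (λ A div → sufficient A (Equivalence.from (iff A) div))

  -- At `c` times the interior point there is a solution in `B`. In whichever cone it lies, the
  -- certificate gives a positive multiple of `c` below 0 modulo the enlarged `k`, hence `c` itself;
  -- covering carries `c ≤ 0` back to `B`.
  some-feasible : ∀ C → ¬ (∀ {p} → p ∈ solutionCones → Infeasible m p C)
  some-feasible C infeasible = c≰0 (Neg⇒≤0 (cover B x z ≤-refl (Sat⇒Holds B x z sat) λ {p} {k} p∈ 0≤k below →
      let g , pos , inf = infeasible p∈ in
      impossible g (positive-neg g (point C) (All.lookup (interior C) pos)) 0≤k
        (Neg-≡ (ev-dot g (point C) c) (inf B {z = z} 0≤k below))))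
    where
    open Semantics B
    x = map (_• c) (point C)
    z = proj₁ (B⊨φ x)
    sat = proj₁ (proj₂ (B⊨φ x))
    impossible : ∀ {k} g → 0ℤ ℤ.< dot g (point C) → 0# ≤ k → Neg k (dot g (point C) • c) → Neg k c
    impossible g pos 0≤k neg with dot g (point C)
    impossible g (ℤ.+<+ _) 0≤k neg | + suc d = Neg-cancel d 0≤k neg

  -- Every cone outside `ps` already has a certificate, and certificates survive refinement because
  -- the forms of a cell only accumulate. An exhausted list contradicts `some-feasible`.
  search : ∀ C ps → (∀ {p} → p ∈ ps → p ∈ solutionCones) →
    (∀ {p} → p ∈ solutionCones → p ∈ ps ⊎ Infeasible m p C) → Reduction (forms C)
  search C [] _ rest = ⊥-elim (some-feasible C λ p∈ → [ (λ ()) , (λ inf → inf) ]′ (rest p∈))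
  search C (p ∷ ps) ps⊆ rest = decide m C p λ
    { D C≼D (inj₁ (β , zs , feas)) → LinearSolution.reduction D (ps⊆ (here refl)) β zs feas
    ; D C≼D (inj₂ inf) → search D ps (λ q∈ → ps⊆ (there q∈)) λ q∈ → remaining {D} C≼D inf (rest q∈) }
    where
    remaining : ∀ {D q} → C ≼ D → Infeasible m p D → q ∈ p ∷ ps ⊎ Infeasible m q C → q ∈ ps ⊎ Infeasible m q D
    remaining C≼D inf (inj₁ (here refl)) = inj₂ inf
    remaining C≼D inf (inj₁ (there q∈)) = inj₁ q∈
    remaining C≼D inf (inj₂ (g , pos , inf′)) = inj₂ (g , C≼D pos , inf′)

  whole-space : Reduction []
  whole-space = search (record { forms = [] ; point = 𝟎 ; interior = [] }) solutionCones (λ p∈ → p∈) inj₁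

  Models⇔Divisible : Σ ℕ λ d → (A : AbelianLGroup a) → Models A φ ⇔ Divisible A (suc d)
  Models⇔Divisible = let d , necessary , sufficient = whole-space in d , λ A → let open Semantics A in
    mk⇔ (necessary A) λ div x → let z , holds = sufficient A div x ≤-refl [] in
      z , Holds⇒Sat A x z holds , λ z′ sat′ →
        lookup-ext λ i → ≈⇒≡ (unique A x z′ z ≤-refl (Sat⇒Holds A x z′ sat′) holds i)
    where
    lookup-ext : ∀ {k} {X : Set a} {xs ys : Vec X k} → (∀ i → lookup xs i ≡ lookup ys i) → xs ≡ ys
    lookup-ext {xs = []}     {[]}     eq = refl
    lookup-ext {xs = x ∷ xs} {y ∷ ys} eq = cong₂ _∷_ (eq zero) (lookup-ext (λ i → eq (suc i)))

-- Divisibility expressed by the sentences `δ k`.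

⟦·⟧ : ∀ {a} (A : AbelianLGroup a) → let open Semantics A in
  ∀ {n} k (t : Term n) ρ → ⟦ A ⟧ (k · t) ρ ≡ (+ k) • ⟦ A ⟧ t ρ
⟦·⟧ A zero    t ρ = refl
⟦·⟧ A (suc k) t ρ = cong (λ u → ⟦ A ⟧ t ρ + u) (⟦·⟧ A k t ρ)
  where open Semantics A

Divisible⇔Models-δ : ∀ {a} (A : AbelianLGroup a) d → Divisible A (suc d) ⇔ Models A (δ (suc d))
Divisible⇔Models-δ A d = mk⇔ to from
  where
  open Semantics A
  to : Divisible A (suc d) → Models A (δ (suc d))
  to div (y ∷ []) = let w , eq = div y in
    w ∷ [] , trans (⟦·⟧ A (suc d) (var (suc zero)) (y ∷ w ∷ [])) eq ∷ [] ,
    -- Uniqueness of the quotient is torsion-freeness.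
    λ { (w′ ∷ []) (eq′ ∷ []) → cong (_∷ []) (•-cancel A d
      (trans (sym (⟦·⟧ A (suc d) (var (suc zero)) (y ∷ w′ ∷ []))) (trans eq′ (sym eq)))) }
  from : Models A (δ (suc d)) → Divisible A (suc d)
  from models y with models (y ∷ [])
  ... | w ∷ [] , eq ∷ [] , _ = w , trans (sym (⟦·⟧ A (suc d) (var (suc zero)) (y ∷ w ∷ []))) eq

theorem4p12 : {a : Level} (φ : EFD) →
    Σ (AbelianLGroup a) (λ A → Nontrivial A × Models A φ) →
    Σ ℕ (λ k → (k ≥ 1) × ((A : AbelianLGroup a) → Models A φ ⇔ Models A (δ k)))
theorem4p12 φ (B , (b , b≢0) , B⊨φ) =
  let d , iff = Models⇔Divisible φ B B⊨φ b b≢0 in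
  suc d , s≤s z≤n , λ A → Divisible⇔Models-δ A d ⇔-∘ iff A
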